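{- Let $p$ be an odd prime, $1\le m<n$, $\bar B\subseteq[n]\setminus[m]$ with $|\bar B|=b$ and $1\le b\le n-m$. Let $I$ be the saturated generalized order ideal of $\mathbb{GH}(m,n)$ in which every element of $[m]\cup\bar B$ has multiplicity $p-1$ and all other elements have multiplicity $0$, and let $D=\mathbb{F}_p^n\setminus I(\mathbb{GP})$ (saturated notion). Put $Q=(p-1)p^{n-1}$, $c_1=p^{n-m-b}$, $c_0=p^{n-m}-p^{n-m-b}$. Write $u=(v,w)$ with $v\in\mathbb{F}_p^m$, $w\in\mathbb{F}_p^{n-m}$, $\sigma=\sum_{i\le m}v_i\in\mathbb{F}_p$, and $\delta=1$ if the restriction $w_{\bar B}$ of $w$ to the coordinates in $\bar B$ is zero, $\delta=0$ otherwise. Then $\mathcal{C}_D$ is an $[p^n-p^m-p^b+1,\ n]$ code over $\mathbb{F}_p$ with at most six nonzero weights, and for $u\neq0$ the weight of $c_D(u)$, together with the number of nonzero $u$ satisfying each condition, is as follows: \[ \begin{array}{lll} \text{condition on }u=(v,w) & \text{weight} & \text{frequency}\\ v=0,\ \delta=1 & Q & c_1-1\\ v=0,\ \delta=0 & (p-1)(p^{n-1}-p^{b-1}) & c_0\\ v\ne0,\ \sigma=0,\ \delta=1 & (p-1)(p^{n-1}-p^{m-1}) & (p^{m-1}-1)c_1\\ v\ne0,\ \sigma=0,\ \delta=0 & (p-1)(p^{n-1}-p^{m-1}-p^{b-1}) & (p^{m-1}-1)c_0\\ \sigma\ne0,\ \delta=1 & (p-1)(p^{n-1}-p^{m-1})-p^b+1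 & (p^m-p^{m-1})c_1\\ \sigma\ne0,\ \delta=0 & (p-1)(p^{n-1}-p^{m-1}-p^{b-1})+1 & (p^m-p^{m-1})c_0 \end{array} \]
   Context: $[n]=\{1,\dots,n\}$. For $D\subseteq\mathbb{F}_p^n$ the code is $\mathcal{C}_D=\{c_D(u)=(u\cdot x)_{x\in D}:u\in\mathbb{F}_p^n\}$, where $u\cdot x=\sum_i u_ix_i$. An $[N,k]$ code is a linear code of length $N$ and dimension $k$; weights are Hamming weights. Generalized order ideals: $[n]_{p-1}$ is the multiset in which each $i\in[n]$ has multiplicity $p-1$. A sub-multiset $J$ is identified with its multiplicity vector $(J_1,\dots,J_n)\in\{0,\dots,p-1\}^n=\mathbb{F}_p^n$; $J\subseteq J'$ means $J_i\le J'_i$ (as integers) for all $i$; $\bar J=\{i:J_i\ne0\}$ is the support. The hierarchical poset $\mathbb{H}(m,n)$ on $[n]$ has as its only strict relations $i\prec j$ for all $i\in[m]$, $j\in[n]\setminus[m]$; $\mathbb{GH}(m,n)$ denotes $[n]_{p-1}$ together with this order. $J$ is a saturated generalized order ideal if $\bar J$ is an order ideal (down-closed subset) of $\mathbb{H}(m,n)$ and $J_i=p-1$ whenever $j\in\bar J$ and $i\prec j$. For a saturated generalized order ideal $I$, $I(\mathbb{GP})\subseteq\mathbb{F}_p^n$ is the set of all saturated generalized order ideals contained in $I$. -}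

module Defs where

open import Data.Bool.Base using (if_then_else_)
open import Data.Fin.Base using (Fin; toℕ)
import Data.Fin.Base as Fin
import Data.Fin.Properties as Fin
open import Data.Fin.Subset using (Subset; _∈_)
open import Data.Fin.Subset.Properties using (_∈?_)
open import Data.Integer.Base using (ℤ; +_)
open import Data.List.Base using (List; [_]; length; filter; allFin; cartesianProductWith)
import Data.List.Membership.Propositional as List
open import Data.List.Relation.Unary.Unique.Propositional using (Unique)
open import Data.Nat
open import Data.Nat.DivMod using (_mod_; m<n⇒m%n≡m)
import Data.Nat.Properties as ℕ
open import Data.Product.Base using (_×_; _,_; Σ-syntax; ∃-syntax)
open import Data.Vec.Base using (Vec; []; _∷_; lookup; tabulate; replicate; zipWith; foldr′; map; count; truncate; fromList)
open import Data.Vec.Properties using (lookup∘tabulate)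
open import Data.Vec.Relation.Unary.All using (All)
open import Function.Bundles using (_⇔_)
open import Level using (0ℓ)
open import Relation.Binary.Core using (Rel)
open import Relation.Binary.PropositionalEquality.Core using (_≡_; _≢_; refl; trans; sym)
open import Relation.Binary.PropositionalEquality.Properties using (isEquivalence)
open import Relation.Binary.Structures using (IsStrictPartialOrder)
open import Relation.Nullary.Decidable
  using (Dec; does; dec-true; ¬?; _×-dec_; _⊎-dec_; _→-dec_)
open import Relation.Unary using (Pred; Decidable; ∁)
open import Relation.Unary.Properties using (∁?)

------------------------------------------------------------------------
-- Arithmetic in 𝔽ₚ = ℤ/p, with Fin p as the set of residues 0, …, p - 1

infixl 6 _+ₚ_ _+ᵛ_
infixl 7 _*ₚ_ _*ᵛ_ _·_

0ₚ : ∀ {p} .{{_ : NonZero p}} → Fin p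
0ₚ {p} = 0 mod p

_+ₚ_ : ∀ {p} .{{_ : NonZero p}} → Fin p → Fin p → Fin p
_+ₚ_ {p} a b = (toℕ a + toℕ b) mod p

_*ₚ_ : ∀ {p} .{{_ : NonZero p}} → Fin p → Fin p → Fin p
_*ₚ_ {p} a b = (toℕ a * toℕ b) mod p

sumₚ : ∀ {p} .{{_ : NonZero p}} {n} → Vec (Fin p) n → Fin p
sumₚ = foldr′ _+ₚ_ 0ₚ

0ᵛ : ∀ {p} .{{_ : NonZero p}} {n} → Vec (Fin p) n
0ᵛ = replicate _ 0ₚ

_+ᵛ_ : ∀ {p} .{{_ : NonZero p}} {n} → Vec (Fin p) n → Vec (Fin p) n → Vec (Fin p) n
_+ᵛ_ = zipWith _+ₚ_

_*ᵛ_ : ∀ {p} .{{_ : NonZero p}} {n} → Fin p → Vec (Fin p) n → Vec (Fin p) n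
a *ᵛ x = map (a *ₚ_) x

_·_ : ∀ {p} .{{_ : NonZero p}} {n} → Vec (Fin p) n → Vec (Fin p) n → Fin p
u · x = sumₚ (zipWith _*ₚ_ u x)

allVecs : ∀ p n → List (Vec (Fin p) n)
allVecs p zero    = [ [] ]
allVecs p (suc n) = cartesianProductWith _∷_ (allFin p) (allVecs p n)

------------------------------------------------------------------------
-- Linear codes

module _ {p : ℕ} .{{_ : NonZero p}} where

  linComb : ∀ {k N} → Vec (Fin p) k → Vec (Vec (Fin p) N) k → Vec (Fin p) N
  linComb as bs = foldr′ _+ᵛ_ 0ᵛ (zipWith _*ᵛ_ as bs)

  IsLinear : ∀ {N} → Pred (Vec (Fin p) N) 0ℓ → Set
  IsLinear C = C 0ᵛ
             × (∀ x y → C x → C y → C (x +ᵛ y))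
             × (∀ a x → C x → C (a *ᵛ x))

  HasDimension : ∀ {N} → Pred (Vec (Fin p) N) 0ℓ → ℕ → Set
  HasDimension {N} C k = Σ[ bs ∈ Vec (Vec (Fin p) N) k ]
      All C bs
    × (∀ as → linComb as bs ≡ 0ᵛ → as ≡ 0ᵛ)
    × (∀ x → C x → ∃[ as ] x ≡ linComb as bs)

  -- The parameter N is an integer so that formulas with subtraction are exact.
  IsCode[_,_] : ℤ → ℕ → ∀ {N} → Pred (Vec (Fin p) N) 0ℓ → Set
  IsCode[ N , k ] {N′} C = + N′ ≡ N × IsLinear C × HasDimension C k

  wt : ∀ {N} → Vec (Fin p) N → ℕ
  wt = count (λ a → ¬? (a Fin.≟ 0ₚ))

  AtMostNonzeroWeights : ∀ {N} → ℕ → Pred (Vec (Fin p) N) 0ℓ → Set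
  AtMostNonzeroWeights k C = Σ[ ws ∈ List ℕ ]
      length ws ≤ k
    × (∀ c → C c → wt c ≢ 0 → wt c List.∈ ws)

  -- The coordinates of codewords are indexed by D; as D is finite, it is
  -- listed (without repetition) in the order of allVecs.
  module _ {n : ℕ} {D : Pred (Vec (Fin p) n) 0ℓ} (D? : Decidable D) where

    points : List (Vec (Fin p) n)
    points = filter D? (allVecs p n)

    codeword : Vec (Fin p) n → Vec (Fin p) (length points)
    codeword u = map (u ·_) (fromList points)

    Code : Pred (Vec (Fin p) (length points)) 0ℓ
    Code c = ∃[ u ] c ≡ codeword u

------------------------------------------------------------------------
-- Saturated generalized order ideals of a finite poset, given by its strict
-- order _≺_ on Fin n.  A sub-multiset of [n]ₚ₋₁ is its vector of multiplicities.

module _ {p n : ℕ} where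

  _⊆ᵐ_ : Rel (Vec (Fin p) n) 0ℓ
  J ⊆ᵐ J′ = ∀ i → lookup J i Fin.≤ lookup J′ i

  support : Vec (Fin p) n → Pred (Fin n) 0ℓ
  support J i = toℕ (lookup J i) ≢ 0

  IsSaturatedIdeal : Rel (Fin n) 0ℓ → Pred (Vec (Fin p) n) 0ℓ
  IsSaturatedIdeal _≺_ J =
      (∀ i j → i ≺ j → support J j → support J i)
    × (∀ i j → i ≺ j → support J j → toℕ (lookup J i) ≡ p ∸ 1)

  -- The set I(𝔾ℙ).
  IdealsIn : Rel (Fin n) 0ℓ → Vec (Fin p) n → Pred (Vec (Fin p) n) 0ℓ
  IdealsIn _≺_ I J = IsSaturatedIdeal _≺_ J × J ⊆ᵐ I

  idealsIn? : ∀ {_≺_} → (∀ i j → Dec (i ≺ j)) → ∀ I → Decidable (IdealsIn _≺_ I)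
  idealsIn? _≺?_ I J =
    (  Fin.all? (λ i → Fin.all? λ j → (i ≺? j) →-dec (support? j →-dec support? i))
     ×-dec
       Fin.all? (λ i → Fin.all? λ j →
         (i ≺? j) →-dec (support? j →-dec (toℕ (lookup J i) ≟ p ∸ 1))))
    ×-dec Fin.all? (λ i → lookup J i Fin.≤? lookup I i)
    where
    support? : Decidable (support J)
    support? i = ¬? (toℕ (lookup J i) ≟ 0)

------------------------------------------------------------------------
-- The hierarchical poset ℍ(m,n).  The element i of [n] is the element i - 1
-- of Fin n, so [m] consists of those i with toℕ i < m.

ℍ : ∀ m n → Rel (Fin n) 0ℓ
ℍ m n i j = toℕ i < m × m ≤ toℕ j

ℍ? : ∀ m n i j → Dec (ℍ m n i j)
ℍ? m n i j = (toℕ i <? m) ×-dec (m ≤? toℕ j)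

ℍ-isStrictPartialOrder : ∀ m n → IsStrictPartialOrder _≡_ (ℍ m n)
ℍ-isStrictPartialOrder m n = record
  { isEquivalence = isEquivalence
  ; irrefl        = λ { refl (i<m , m≤i) → ℕ.<⇒≱ i<m m≤i }
  ; trans         = λ (i<m , _) (_ , m≤k) → i<m , m≤k
  ; <-resp-≈      = (λ { refl q → q }) , (λ { refl q → q })
  }

module _ {p : ℕ} .{{_ : NonZero p}} {n : ℕ} (m : ℕ) (B : Subset n) where

  -- The ideal I with multiplicity p - 1 on [m] ∪ B and 0 elsewhere.
  fullIdeal : Vec (Fin p) n
  fullIdeal = tabulate λ i →
    if does ((toℕ i <? m) ⊎-dec (i ∈? B)) then (p ∸ 1) mod p else 0ₚ

  fullIdeal-isSaturated : IsSaturatedIdeal (ℍ m n) fullIdeal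
  fullIdeal-isSaturated =
    (λ i j (i<m , _) j∈ i∉ → j∈ (ℕ.n≤0⇒n≡0 (ℕ.≤-trans (toℕ≤p-1 (lookup fullIdeal j))
      (ℕ.≤-reflexive (trans (sym (max-on-[m] i i<m)) i∉))))) ,
    (λ i j (i<m , _) _ → max-on-[m] i i<m)
    where
    toℕ≤p-1 : ∀ (a : Fin p) → toℕ a ≤ p ∸ 1
    toℕ≤p-1 a = ℕ.∸-monoˡ-≤ 1 (Fin.toℕ<n a)

    p-1<p : p ∸ 1 < p
    p-1<p = ℕ.≤-reflexive (ℕ.suc-pred p)

    max-on-[m] : ∀ i → toℕ i < m → toℕ (lookup fullIdeal i) ≡ p ∸ 1
    max-on-[m] i i<m
      rewrite lookup∘tabulate (λ i →
        if does ((toℕ i <? m) ⊎-dec (i ∈? B)) then (p ∸ 1) mod p else 0ₚ {p}) i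
            | dec-true (toℕ i <? m) i<m
      = trans (Fin.toℕ-fromℕ< _) (m<n⇒m%n≡m p-1<p)

  definingSet : Pred (Vec (Fin p) n) 0ℓ
  definingSet = ∁ (IdealsIn (ℍ m n) fullIdeal)

  definingSet? : Decidable definingSet
  definingSet? = ∁? (idealsIn? (ℍ? m n) fullIdeal)

------------------------------------------------------------------------
-- The weight table

module _ {p : ℕ} .{{_ : NonZero p}} {n : ℕ} where

  -- The vector v of u = (v , w).
  head[_] : ∀ {m} → m < n → Vec (Fin p) n → Vec (Fin p) m
  head[ m<n ] u = truncate (ℕ.<⇒≤ m<n) u

  -- For B ⊆ [n] ∖ [m], the restriction of w to B is that of u = (v , w).
  δ : Subset n → Vec (Fin p) n → ℕ
  δ B u =
    if does (Fin.all? λ i → (i ∈? B) →-dec (lookup u i Fin.≟ 0ₚ)) then 1 else 0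

HasSize : ∀ {A : Set} → Pred A 0ℓ → ℤ → Set
HasSize {A} P k = Σ[ xs ∈ List A ]
    Unique xs
  × (∀ x → x List.∈ xs ⇔ P x)
  × + length xs ≡ k

-- Every nonzero u satisfying P has a codeword of weight w, and there are f such u.
Row : ∀ {p} .{{_ : NonZero p}} {n N} → (Vec (Fin p) n → Vec (Fin p) N) →
      Pred (Vec (Fin p) n) 0ℓ → ℤ → ℤ → Set
Row c P w f = (∀ u → u ≢ 0ᵛ → P u → + wt (c u) ≡ w)
            × HasSize (λ u → u ≢ 0ᵛ × P u) f

{-# OPTIONS --safe #-}
module Submission where

-- Put M = [m].  The support of a saturated ideal J inside the ideal of full multiplicity
-- on M and B either lies in M, or contains an element above M, and then J is p - 1 on all
-- of M.  So the set of these ideals is the union of two coordinate flats: the vectors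
-- that vanish off M, and the vectors that agree off B with the vector top that is -1 on
-- M and 0 elsewhere.  The two flats meet in the single point top (idealsIn-fullIdeal,
-- flats-meet).  By inclusion and exclusion the weight of the codeword of u is the number
-- of x with u · x nonzero in the whole space, minus the numbers in the two flats, plus the
-- number at top (wt-codeword, card-definingSet).
--
-- On a flat through a with free coordinates F, the value u · x is equidistributed if u
-- does not vanish on F, since the equation can be solved for one free coordinate
-- (p*#-flatSection), and is constantly u · a if u vanishes on F (dot-flat).  So each of
-- the four numbers is (p - 1) p^(k-1), 0 or p^k with k the size of F.  Since
-- u · top = - σ, they depend only on whether v = 0, σ = 0 and δ = 1; these are the six
-- weights.
--
-- The conditions v = 0 and δ = 1 define coordinate subspaces, and σ = 0 a hyperplane, so
-- the same two counts give the sizes of all intersections.  Each condition of the table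
-- describes the difference of two nested sets built from these.
--
-- The codewords of the unit vectors span the code.  They are independent because no
-- nonzero u is orthogonal to the defining set D: for a fixed coordinate j outside M, the
-- vectors e_j and e_k + e_j with k different from j lie in D (definingSet-separates).
-- Here p must be odd, so that an entry 1 in M is not -1.

open import Defs
import Algebra.Consequences.Propositional as Consequences
import Algebra.Definitions as AlgebraicDefinitions
import Algebra.Properties.CommutativeSemigroup as CommutativeSemigroupProperties
open import Data.Bool.Base using (if_then_else_)
open import Data.Fin.Base using (Fin; toℕ; zero; suc)
import Data.Fin.Base as Fin
import Data.Fin.Properties as Fin
open import Data.Fin.Subset
  using (Subset; inside; outside; _∈_; _∉_; ∣_∣; ⊥; ⊤; ∁) renaming (_∪_ to _∪ˢ_)
open import Data.Fin.Subset.Properties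
  using (_∈?_; drop-there; ∉⊥; ∈⊤; ∣⊥∣≡0; ∣⊤∣≡n; ∣∁p∣≡n∸∣p∣; x∉∁p⇒x∈p; x∈p⇒x∉∁p; x∉p⇒x∈∁p;
         x∈p∪q⁻; x∈p∪q⁺)
open import Data.Integer.Base using (ℤ; +_; _+_; _-_; _*_; 0ℤ; 1ℤ)
import Data.Integer.Base as ℤ
import Data.Integer.Properties as ℤ
import Data.Integer.Tactic.RingSolver as ℤ-Solver
open import Data.List.Base using (List; []; _∷_; _++_; length; filter; allFin; cartesianProductWith)
import Data.List.Base as List
import Data.List.Properties as List
import Data.List.Membership.Propositional as List
open import Data.List.Membership.Propositional.Properties
  using (∈-filter⁺; ∈-filter⁻; ∈-allFin; ∈-cartesianProductWith⁺)
open import Data.List.Relation.Unary.Any using (here; there)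
import Data.List.Relation.Unary.All as All
open import Data.List.Relation.Unary.Unique.Propositional using (Unique; []; _∷_)
import Data.List.Relation.Unary.Unique.Propositional.Properties as Unique
open import Data.Nat.Base
  using (ℕ; zero; suc; NonZero; _≤_; _<_; z≤n; s≤s; _^_; _∸_; >-nonZero⁻¹; nonTrivial⇒n>1)
import Data.Nat.Base as ℕ
import Data.Nat.Properties as ℕ
open import Data.Nat.Properties using (_<?_; _≤?_)
open import Data.Nat.Divisibility using (_∣_; _∤_; ∣-refl; n∣m⇒m%n≡0; m%n≡0⇒n∣m)
open import Data.Nat.DivMod
  using (_%_; _mod_; m%n<n; m<n⇒m%n≡m; n%n≡0; %-distribˡ-+; %-distribˡ-*)
open import Data.Nat.Primality using (Prime; euclidsLemma; prime⇒nonTrivial)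
open import Data.Product.Base using (_×_; _,_; ∃-syntax; proj₁; proj₂)
open import Data.Sum.Base using (_⊎_; inj₁; inj₂)
import Data.Sum.Base as Sum
open import Data.Unit.Base using (tt)
open import Data.Vec.Base using (Vec; []; _∷_; lookup; fromList; tabulate; _[_]≔_)
import Data.Vec.Base as Vec
import Data.Vec.Properties as Vec
import Data.Vec.Relation.Unary.All.Properties as VecAll
open import Function.Base using (_∘_)
open import Function.Bundles using (mk⇔)
open import Level using (0ℓ)
open import Relation.Binary.PropositionalEquality
  using (_≡_; _≢_; refl; sym; trans; cong; cong₂; subst; module ≡-Reasoning)
open import Relation.Nullary.Decidable
  using (Dec; does; yes; no; ¬?; _×-dec_; _⊎-dec_; _→-dec_; dec-true; dec-false;
         decidable-stable)
open import Relation.Nullary.Negation using (¬_; contradiction)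
open import Relation.Unary using (Pred; Decidable; _⊆_; _≐_; _∩_; _∪_) renaming (∁ to ∁ᵖ)
open import Relation.Unary.Properties using (_∩?_; ∁?; U?)

------------------------------------------------------------------------
-- The prime field

module _ {p : ℕ} .{{_ : NonZero p}} where

  open AlgebraicDefinitions (_≡_ {A = Fin p})

  -- The map x ↦ x mod p is a surjective semiring homomorphism, so the laws of
  -- 𝔽ₚ follow from those of ℕ.
  private
    toℕ-mod : ∀ x → toℕ (x mod p) ≡ x % p
    toℕ-mod x = Fin.toℕ-fromℕ< (m%n<n x p)

    mod-cong : ∀ {x y} → x % p ≡ y % p → x mod p ≡ y mod p
    mod-cong {x} {y} eq =
      Fin.toℕ-injective (trans (toℕ-mod x) (trans eq (sym (toℕ-mod y))))

    mod-toℕ : ∀ (a : Fin p) → toℕ a mod p ≡ a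
    mod-toℕ a = Fin.toℕ-injective (trans (toℕ-mod (toℕ a)) (m<n⇒m%n≡m (Fin.toℕ<n a)))

    mod-+ : ∀ x y → (x mod p) +ₚ (y mod p) ≡ (x ℕ.+ y) mod p
    mod-+ x y = mod-cong (trans (cong (_% p) (cong₂ ℕ._+_ (toℕ-mod x) (toℕ-mod y)))
                                (sym (%-distribˡ-+ x y p)))

    mod-* : ∀ x y → (x mod p) *ₚ (y mod p) ≡ (x ℕ.* y) mod p
    mod-* x y = mod-cong (trans (cong (_% p) (cong₂ ℕ._*_ (toℕ-mod x) (toℕ-mod y)))
                                (sym (%-distribˡ-* x y p)))

  +ₚ-comm : Commutative _+ₚ_
  +ₚ-comm a b = cong (_mod p) (ℕ.+-comm (toℕ a) (toℕ b))

  *ₚ-comm : Commutative _*ₚ_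
  *ₚ-comm a b = cong (_mod p) (ℕ.*-comm (toℕ a) (toℕ b))

  +ₚ-assoc : Associative _+ₚ_
  +ₚ-assoc a b c = begin
    ((x ℕ.+ y) mod p) +ₚ c          ≡⟨ cong (((x ℕ.+ y) mod p) +ₚ_) (mod-toℕ c) ⟨
    ((x ℕ.+ y) mod p) +ₚ (z mod p)  ≡⟨ mod-+ (x ℕ.+ y) z ⟩
    (x ℕ.+ y ℕ.+ z) mod p           ≡⟨ cong (_mod p) (ℕ.+-assoc x y z) ⟩
    (x ℕ.+ (y ℕ.+ z)) mod p         ≡⟨ mod-+ x (y ℕ.+ z) ⟨
    (x mod p) +ₚ ((y ℕ.+ z) mod p)  ≡⟨ cong (_+ₚ ((y ℕ.+ z) mod p)) (mod-toℕ a) ⟩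
    a +ₚ ((y ℕ.+ z) mod p)          ∎
    where open ≡-Reasoning
          x = toℕ a
          y = toℕ b
          z = toℕ c

  *ₚ-assoc : Associative _*ₚ_
  *ₚ-assoc a b c = begin
    ((x ℕ.* y) mod p) *ₚ c          ≡⟨ cong (((x ℕ.* y) mod p) *ₚ_) (mod-toℕ c) ⟨
    ((x ℕ.* y) mod p) *ₚ (z mod p)  ≡⟨ mod-* (x ℕ.* y) z ⟩
    (x ℕ.* y ℕ.* z) mod p           ≡⟨ cong (_mod p) (ℕ.*-assoc x y z) ⟩
    (x ℕ.* (y ℕ.* z)) mod p         ≡⟨ mod-* x (y ℕ.* z) ⟨
    (x mod p) *ₚ ((y ℕ.* z) mod p)  ≡⟨ cong (_*ₚ ((y ℕ.* z) mod p)) (mod-toℕ a) ⟩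
    a *ₚ ((y ℕ.* z) mod p)          ∎
    where open ≡-Reasoning
          x = toℕ a
          y = toℕ b
          z = toℕ c

  *ₚ-distribˡ-+ₚ : _*ₚ_ DistributesOverˡ _+ₚ_
  *ₚ-distribˡ-+ₚ a b c = begin
    a *ₚ ((y ℕ.+ z) mod p)                  ≡⟨ cong (_*ₚ ((y ℕ.+ z) mod p)) (mod-toℕ a) ⟨
    (x mod p) *ₚ ((y ℕ.+ z) mod p)          ≡⟨ mod-* x (y ℕ.+ z) ⟩
    (x ℕ.* (y ℕ.+ z)) mod p                 ≡⟨ cong (_mod p) (ℕ.*-distribˡ-+ x y z) ⟩
    (x ℕ.* y ℕ.+ x ℕ.* z) mod p             ≡⟨ mod-+ (x ℕ.* y) (x ℕ.* z) ⟨
    ((x ℕ.* y) mod p) +ₚ ((x ℕ.* z) mod p)  ∎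
    where open ≡-Reasoning
          x = toℕ a
          y = toℕ b
          z = toℕ c

  *ₚ-distribʳ-+ₚ : _*ₚ_ DistributesOverʳ _+ₚ_
  *ₚ-distribʳ-+ₚ = Consequences.comm∧distrˡ⇒distrʳ *ₚ-comm *ₚ-distribˡ-+ₚ

  +ₚ-identityˡ : LeftIdentity 0ₚ _+ₚ_
  +ₚ-identityˡ a = trans (cong (0ₚ +ₚ_) (sym (mod-toℕ a))) (trans (mod-+ 0 (toℕ a)) (mod-toℕ a))

  +ₚ-identityʳ : RightIdentity 0ₚ _+ₚ_
  +ₚ-identityʳ = Consequences.comm∧idˡ⇒idʳ +ₚ-comm +ₚ-identityˡ

  -- For p = 1 this is the only residue, 0.
  1ₚ : Fin p
  1ₚ = 1 mod p

  infix 8 -ₚ_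
  -- The residue 0 is negated through p mod p = 0.
  -ₚ_ : Fin p → Fin p
  -ₚ a = (p ∸ toℕ a) mod p

  *ₚ-identityˡ : LeftIdentity 1ₚ _*ₚ_
  *ₚ-identityˡ a = begin
    1ₚ *ₚ a                ≡⟨ cong (1ₚ *ₚ_) (mod-toℕ a) ⟨
    1ₚ *ₚ (toℕ a mod p)    ≡⟨ mod-* 1 (toℕ a) ⟩
    (1 ℕ.* toℕ a) mod p    ≡⟨ cong (_mod p) (ℕ.*-identityˡ (toℕ a)) ⟩
    toℕ a mod p            ≡⟨ mod-toℕ a ⟩
    a                      ∎
    where open ≡-Reasoning

  -ₚ-inverseʳ : RightInverse 0ₚ -ₚ_ _+ₚ_
  -ₚ-inverseʳ a = begin
    a +ₚ (-ₚ a)                            ≡⟨ cong (_+ₚ (-ₚ a)) (mod-toℕ a) ⟨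
    (toℕ a mod p) +ₚ ((p ∸ toℕ a) mod p)   ≡⟨ mod-+ (toℕ a) (p ∸ toℕ a) ⟩
    (toℕ a ℕ.+ (p ∸ toℕ a)) mod p          ≡⟨ cong (_mod p) (ℕ.m+[n∸m]≡n (Fin.toℕ≤n a)) ⟩
    p mod p                                ≡⟨ mod-cong p%p≡0%p ⟩
    0ₚ                                     ∎
    where
    open ≡-Reasoning
    p%p≡0%p : p % p ≡ 0 % p
    p%p≡0%p = trans (n%n≡0 p) (sym (m<n⇒m%n≡m (>-nonZero⁻¹ p)))

  *ₚ-identityʳ : RightIdentity 1ₚ _*ₚ_
  *ₚ-identityʳ = Consequences.comm∧idˡ⇒idʳ *ₚ-comm *ₚ-identityˡ

  toℕ-0ₚ : toℕ (0ₚ {p}) ≡ 0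
  toℕ-0ₚ = trans (toℕ-mod 0) (m<n⇒m%n≡m (>-nonZero⁻¹ p))

  *ₚ-zeroˡ : LeftZero 0ₚ _*ₚ_
  *ₚ-zeroˡ a = cong (λ x → (x ℕ.* toℕ a) mod p) toℕ-0ₚ

  *ₚ-zeroʳ : RightZero 0ₚ _*ₚ_
  *ₚ-zeroʳ = Consequences.comm∧zeˡ⇒zeʳ *ₚ-comm *ₚ-zeroˡ

  toℕ≡0⇒≡0ₚ : ∀ {a : Fin p} → toℕ a ≡ 0 → a ≡ 0ₚ
  toℕ≡0⇒≡0ₚ eq = Fin.toℕ-injective (trans eq (sym toℕ-0ₚ))

  toℕ-1ₚ : 1 < p → toℕ 1ₚ ≡ 1
  toℕ-1ₚ 1<p = trans (toℕ-mod 1) (m<n⇒m%n≡m 1<p)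

  -- The maximal multiplicity p - 1 as a field element.
  -1ₚ : Fin p
  -1ₚ = (p ∸ 1) mod p

  toℕ--1ₚ : toℕ -1ₚ ≡ p ∸ 1
  toℕ--1ₚ = trans (toℕ-mod (p ∸ 1)) (m<n⇒m%n≡m (ℕ.≤-reflexive (ℕ.suc-pred p)))

  1ₚ≢0ₚ : 1 < p → 1ₚ ≢ 0ₚ
  1ₚ≢0ₚ 1<p eq = ℕ.1+n≢0 (trans (sym (toℕ-1ₚ 1<p)) (trans (cong toℕ eq) toℕ-0ₚ))

  -1ₚ≢0ₚ : 1 < p → -1ₚ ≢ 0ₚ
  -1ₚ≢0ₚ 1<p eq = ℕ.m>n⇒m∸n≢0 1<p (trans (sym toℕ--1ₚ) (trans (cong toℕ eq) toℕ-0ₚ))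

  1ₚ≢-1ₚ : 2 < p → 1ₚ ≢ -1ₚ
  1ₚ≢-1ₚ 2<p eq = ℕ.m>n⇒m∸n≢0 2<p (trans (sym (ℕ.∸-+-assoc p 1 1))
    (cong (_∸ 1) (trans (sym toℕ--1ₚ) (trans (cong toℕ (sym eq)) (toℕ-1ₚ (ℕ.<⇒≤ 2<p))))))

  private
    toℕ∣⇒≡0ₚ : ∀ (a : Fin p) → p ∣ toℕ a → a ≡ 0ₚ
    toℕ∣⇒≡0ₚ a p∣a = toℕ≡0⇒≡0ₚ
      (trans (sym (m<n⇒m%n≡m (Fin.toℕ<n a))) (n∣m⇒m%n≡0 (toℕ a) p p∣a))

  *ₚ-noZeroDivisors : Prime p → ∀ (a b : Fin p) → a *ₚ b ≡ 0ₚ → a ≡ 0ₚ ⊎ b ≡ 0ₚ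
  *ₚ-noZeroDivisors p-prime a b ab≡0 =
    Sum.map (toℕ∣⇒≡0ₚ a) (toℕ∣⇒≡0ₚ b) (euclidsLemma (toℕ a) (toℕ b) p-prime
      (m%n≡0⇒n∣m (toℕ a ℕ.* toℕ b) p
        (trans (sym (toℕ-mod (toℕ a ℕ.* toℕ b))) (trans (cong toℕ ab≡0) toℕ-0ₚ))))

-- An injective endofunction of a finite set hits every point: missing c, it
-- would inject Fin p into Fin p with c removed.
injective⇒hits : ∀ {p} (f : Fin p → Fin p) → (∀ {a b} → f a ≡ f b → a ≡ b) →
                 ∀ c → ∃[ a ] f a ≡ c
injective⇒hits {zero} f inj ()
injective⇒hits {suc p} f inj c with Fin.any? (λ a → f a Fin.≟ c)
... | yes hit = hit
... | no miss = contradiction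
  (Fin.injective⇒≤ {f = λ a → Fin.punchOut (≢c a)}
    (inj ∘ Fin.punchOut-injective (≢c _) (≢c _)))
  ℕ.1+n≰n
  where
  ≢c : ∀ a → c ≢ f a
  ≢c a eq = miss (a , sym eq)

module _ {p : ℕ} .{{_ : NonZero p}} where

  +ₚ-cancelʳ : ∀ (c : Fin p) {a b} → a +ₚ c ≡ b +ₚ c → a ≡ b
  +ₚ-cancelʳ c {a} {b} eq = begin
    a                   ≡⟨ undo a ⟨
    (a +ₚ c) +ₚ (-ₚ c)  ≡⟨ cong (_+ₚ (-ₚ c)) eq ⟩
    (b +ₚ c) +ₚ (-ₚ c)  ≡⟨ undo b ⟩
    b                   ∎
    where
    open ≡-Reasoning
    undo : ∀ d → (d +ₚ c) +ₚ (-ₚ c) ≡ d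
    undo d = trans (+ₚ-assoc d c (-ₚ c))
      (trans (cong (d +ₚ_) (-ₚ-inverseʳ c)) (+ₚ-identityʳ d))

  +ₚ-cancelˡ : ∀ (c : Fin p) {a b} → c +ₚ a ≡ c +ₚ b → a ≡ b
  +ₚ-cancelˡ c {a} {b} eq = +ₚ-cancelʳ c (trans (+ₚ-comm a c) (trans eq (+ₚ-comm c b)))

module _ {p : ℕ} .{{_ : NonZero p}} (p-prime : Prime p) where

  *ₚ-cancelˡ : ∀ {t : Fin p} → t ≢ 0ₚ → ∀ {a b} → t *ₚ a ≡ t *ₚ b → a ≡ b
  *ₚ-cancelˡ {t} t≢0 {a} {b} ta≡tb with *ₚ-noZeroDivisors p-prime t (a +ₚ (-ₚ b)) t[a-b]≡0
    where
    open ≡-Reasoning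
    t[a-b]≡0 : t *ₚ (a +ₚ (-ₚ b)) ≡ 0ₚ
    t[a-b]≡0 = begin
      t *ₚ (a +ₚ (-ₚ b))      ≡⟨ *ₚ-distribˡ-+ₚ t a (-ₚ b) ⟩
      t *ₚ a +ₚ t *ₚ (-ₚ b)   ≡⟨ cong (_+ₚ t *ₚ (-ₚ b)) ta≡tb ⟩
      t *ₚ b +ₚ t *ₚ (-ₚ b)   ≡⟨ *ₚ-distribˡ-+ₚ t b (-ₚ b) ⟨
      t *ₚ (b +ₚ (-ₚ b))      ≡⟨ cong (t *ₚ_) (-ₚ-inverseʳ b) ⟩
      t *ₚ 0ₚ                 ≡⟨ *ₚ-zeroʳ t ⟩
      0ₚ                      ∎
  ... | inj₁ t≡0 = contradiction t≡0 t≢0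
  ... | inj₂ a-b≡0 = +ₚ-cancelʳ (-ₚ b) (trans a-b≡0 (sym (-ₚ-inverseʳ b)))

  -- An affine equation in one unknown with nonzero slope has exactly one solution.
  affine-root : ∀ r {t} (s : Fin p) → t ≢ 0ₚ →
    ∃[ c ] r +ₚ (t *ₚ c +ₚ s) ≡ 0ₚ × (∀ {c′} → r +ₚ (t *ₚ c′ +ₚ s) ≡ 0ₚ → c′ ≡ c)
  affine-root r {t} s t≢0 with injective⇒hits (λ c → r +ₚ (t *ₚ c +ₚ s)) inj 0ₚ
    where
    inj : ∀ {a b} → r +ₚ (t *ₚ a +ₚ s) ≡ r +ₚ (t *ₚ b +ₚ s) → a ≡ b
    inj {a} {b} eq = *ₚ-cancelˡ t≢0 (+ₚ-cancelʳ s (+ₚ-cancelˡ r eq))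
  ... | c , root = c , root , λ {c′} root′ → *ₚ-cancelˡ t≢0
          (+ₚ-cancelʳ s (+ₚ-cancelˡ r (trans root′ (sym root))))

------------------------------------------------------------------------
-- Counting the elements of a list that satisfy a predicate

-- The number of entries of a list that satisfy P, with repetitions.
count : {A : Set} {P : Pred A 0ℓ} → Decidable P → List A → ℕ
count P? xs = length (filter P? xs)

module _ {A : Set} where

  private
    variable
      P Q R T : Pred A 0ℓ

  count-cong : (P? : Decidable P) (Q? : Decidable Q) → P ≐ Q → ∀ xs →
               count P? xs ≡ count Q? xs
  count-cong P? Q? P≐Q xs = cong length (List.filter-≐ P? Q? P≐Q xs)

  -- Inclusion and exclusion for predicates R and T that are the union and the
  -- intersection of P and Q.
  count-∪-∩ : (P? : Decidable P) (Q? : Decidable Q) (R? : Decidable R) (T? : Decidable T) →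
              R ≐ P ∪ Q → T ≐ P ∩ Q → ∀ xs →
              count R? xs ℕ.+ count T? xs ≡ count P? xs ℕ.+ count Q? xs
  count-∪-∩ P? Q? R? T? R≐ T≐ [] = refl
  count-∪-∩ P? Q? R? T? R≐ T≐ (x ∷ xs)
    with P? x | Q? x | R? x | T? x | count-∪-∩ P? Q? R? T? R≐ T≐ xs
  ... | yes px | yes qx | yes rx | yes tx | ih =
    cong suc (trans (ℕ.+-suc _ _) (trans (cong suc ih) (sym (ℕ.+-suc _ _))))
  ... | yes px | no ¬qx | yes rx | no ¬tx | ih = cong suc ih
  ... | no ¬px | yes qx | yes rx | no ¬tx | ih = trans (cong suc ih) (sym (ℕ.+-suc _ _))
  ... | no ¬px | no ¬qx | no ¬rx | no ¬tx | ih = ih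
  ... | yes px | _      | no ¬rx | _      | _  = contradiction (proj₂ R≐ (inj₁ px)) ¬rx
  ... | _      | yes qx | no ¬rx | _      | _  = contradiction (proj₂ R≐ (inj₂ qx)) ¬rx
  ... | yes px | yes qx | _      | no ¬tx | _  = contradiction (proj₂ T≐ (px , qx)) ¬tx
  ... | no ¬px | _      | _      | yes tx | _  = contradiction (proj₁ (proj₁ T≐ tx)) ¬px
  ... | _      | no ¬qx | _      | yes tx | _  = contradiction (proj₂ (proj₁ T≐ tx)) ¬qx
  ... | no ¬px | no ¬qx | yes rx | _      | _  = contradiction (proj₁ R≐ rx) Sum.[ ¬px , ¬qx ]

  count-filter : (P? : Decidable P) (Q? : Decidable Q) → ∀ xs →
                 count P? (filter Q? xs) ≡ count (Q? ∩? P?) xs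
  count-filter P? Q? [] = refl
  count-filter P? Q? (x ∷ xs) with Q? x
  ... | no _ = count-filter P? Q? xs
  ... | yes _ with P? x
  ...   | yes _ = cong suc (count-filter P? Q? xs)
  ...   | no  _ = count-filter P? Q? xs

  count-all : (P? : Decidable P) → (∀ x → P x) → ∀ xs → count P? xs ≡ length xs
  count-all P? all xs = cong length (List.filter-all P? (All.universal all xs))

  count-none : (P? : Decidable P) → (∀ x → ¬ P x) → ∀ xs → count P? xs ≡ 0
  count-none P? none xs = cong length (List.filter-none P? (All.universal none xs))

  -- A predicate with exactly one solution is satisfied once in a list without
  -- repetition that contains the solution.
  count-unique : (P? : Decidable P) → ∀ {x xs} → Unique xs → x List.∈ xs → P x →
                 (∀ {y} → P y → y ≡ x) → count P? xs ≡ 1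
  count-unique {P = P} P? {x} {xs} xs! x∈xs px only =
    singleton (Unique.filter⁺ P? xs!) (∈-filter⁺ P? x∈xs px)
      (λ y∈ → only (proj₂ (∈-filter⁻ P? {xs = xs} y∈)))
    where
    singleton : ∀ {ys} → Unique ys → x List.∈ ys →
                (∀ {y} → y List.∈ ys → y ≡ x) → length ys ≡ 1
    singleton {y ∷ []} _ _ _ = refl
    singleton {y ∷ z ∷ _} ((y≢z All.∷ _) ∷ _) _ all≡x =
      contradiction (trans (all≡x (here refl)) (sym (all≡x (there (here refl))))) y≢z

  count-++ : (P? : Decidable P) → ∀ xs ys → count P? (xs ++ ys) ≡ count P? xs ℕ.+ count P? ys
  count-++ P? xs ys = trans (cong length (List.filter-++ P? xs ys)) (List.length-++ (filter P? xs))

-- Double counting: if every y satisfying Q is completed to a solution f a y of P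
-- in exactly k ways, and no other y is, then P has k times as many solutions as Q.
count-fibres : ∀ {X Y Z : Set} (f : X → Y → Z) {P : Pred Z 0ℓ} {Q : Pred Y 0ℓ}
  (P? : Decidable P) (Q? : Decidable Q) k xs →
  (∀ y → Q y → count (λ a → P? (f a y)) xs ≡ k) → (∀ a y → P (f a y) → Q y) →
  ∀ ys → count P? (cartesianProductWith f xs ys) ≡ k ℕ.* count Q? ys
count-fibres {Y = Y} f P? Q? k xs fib P⇒Q ys = trans (byFibres xs ys) (total ys)
  where
  exchange : ∀ {a b} c d → b ≡ c ℕ.+ d → a ℕ.+ b ≡ c ℕ.+ (a ℕ.+ d)
  exchange {a} c d refl =
    CommutativeSemigroupProperties.x∙yz≈y∙xz ℕ.+-commutativeSemigroup a c d

  -- The number of pairs (x , y) with P (f x y), summed over y.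
  fibres : List _ → List Y → ℕ
  fibres xs [] = 0
  fibres xs (y ∷ ys) = count (λ a → P? (f a y)) xs ℕ.+ fibres xs ys

  fibres-∷ : ∀ x xs ys →
             fibres (x ∷ xs) ys ≡ count P? (List.map (f x) ys) ℕ.+ fibres xs ys
  fibres-∷ x xs [] = refl
  fibres-∷ x xs (y ∷ ys) with P? (f x y)
  ... | yes _ = cong suc (exchange (count P? (List.map (f x) ys)) (fibres xs ys) (fibres-∷ x xs ys))
  ... | no  _ = exchange (count P? (List.map (f x) ys)) (fibres xs ys) (fibres-∷ x xs ys)

  byFibres : ∀ xs ys → count P? (cartesianProductWith f xs ys) ≡ fibres xs ys
  byFibres [] [] = refl
  byFibres [] (y ∷ ys) = byFibres [] ys
  byFibres (x ∷ xs) ys = begin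
    count P? (row ++ cartesianProductWith f xs ys)            ≡⟨ count-++ P? row _ ⟩
    count P? row ℕ.+ count P? (cartesianProductWith f xs ys)  ≡⟨ cong (count P? row ℕ.+_)
                                                                      (byFibres xs ys) ⟩
    count P? row ℕ.+ fibres xs ys                             ≡⟨ fibres-∷ x xs ys ⟨
    fibres (x ∷ xs) ys                                        ∎
    where
    open ≡-Reasoning
    row = List.map (f x) ys

  total : ∀ ys → fibres xs ys ≡ k ℕ.* count Q? ys
  total [] = sym (ℕ.*-zeroʳ k)
  total (y ∷ ys) with Q? y
  ... | yes q = trans (cong₂ ℕ._+_ (fib y q) (total ys)) (sym (ℕ.*-suc k (count Q? ys)))
  ... | no ¬q = cong₂ ℕ._+_ (count-none (λ a → P? (f a y)) (λ a → ¬q ∘ P⇒Q a y) xs) (total ys)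

------------------------------------------------------------------------
-- Flats and hyperplanes in the space of vectors

allVecs-unique : ∀ p n → Unique (allVecs p n)
allVecs-unique p zero = All.[] ∷ []
allVecs-unique p (suc n) = Unique.cartesianProductWith⁺ _∷_ Vec.∷-injective
  (Unique.allFin⁺ p) (allVecs-unique p n)

∈-allVecs : ∀ {p n} (x : Vec (Fin p) n) → x List.∈ allVecs p n
∈-allVecs [] = here refl
∈-allVecs (a ∷ x) = ∈-cartesianProductWith⁺ _∷_ (∈-allFin a) (∈-allVecs x)

module _ {p n : ℕ} {P : Pred (Vec (Fin p) n) 0ℓ} where

  -- The number of vectors that satisfy P.
  # : Decidable P → ℕ
  # P? = count P? (allVecs p n)

  -- The same number as an integer, for formulas with subtraction.
  card : Decidable P → ℤ
  card P? = + # P?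

  #-unique : (P? : Decidable P) → ∀ {x} → P x → (∀ {y} → P y → y ≡ x) → # P? ≡ 1
  #-unique P? {x} px = count-unique P? (allVecs-unique p n) (∈-allVecs x) px

module _ {p : ℕ} where

  -- If each solution y of Q extends by exactly one head to a solution of P, and every
  -- solution of P arises in this way, then P and Q have equally many solutions.
  fibres-1 : ∀ {n} {P : Pred (Vec (Fin p) (suc n)) 0ℓ} {Q : Pred (Vec (Fin p) n) 0ℓ}
    (P? : Decidable P) (Q? : Decidable Q) →
    (∀ y → Q y → ∃[ a ] P (a ∷ y) × (∀ {b} → P (b ∷ y) → b ≡ a)) →
    (∀ a y → P (a ∷ y) → Q y) → # P? ≡ # Q?
  fibres-1 {n} P? Q? ex P⇒Q = trans
    (count-fibres _∷_ P? Q? 1 (allFin p)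
      (λ y q → let a , pa , only = ex y q in
        count-unique (λ a → P? (a ∷ y)) (Unique.allFin⁺ p) (∈-allFin a) pa only)
      P⇒Q (allVecs p n))
    (ℕ.*-identityˡ _)

  -- If P does not depend on the head, it has p solutions for each solution of Q.
  fibres-p : ∀ {n} {P : Pred (Vec (Fin p) (suc n)) 0ℓ} {Q : Pred (Vec (Fin p) n) 0ℓ}
    (P? : Decidable P) (Q? : Decidable Q) →
    (∀ a y → Q y → P (a ∷ y)) → (∀ a y → P (a ∷ y) → Q y) → # P? ≡ p ℕ.* # Q?
  fibres-p {n} P? Q? Q⇒P P⇒Q =
    count-fibres _∷_ P? Q? p (allFin p)
      (λ y q → trans (count-all (λ a → P? (a ∷ y)) (λ a → Q⇒P a y q) (allFin p))
                     (List.length-tabulate {n = p} (λ i → i)))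
      P⇒Q (allVecs p n)

  -- The vectors that agree with a outside F: the flat through a with free coordinates F.
  -- The entries of a in F play no role.
  Flat : ∀ {n} → Subset n → Vec (Fin p) n → Pred (Vec (Fin p) n) 0ℓ
  Flat F a x = ∀ i → i ∉ F → lookup x i ≡ lookup a i

  flat? : ∀ {n} F (a : Vec (Fin p) n) → Decidable (Flat F a)
  flat? F a x = Fin.all? λ i → ¬? (i ∈? F) →-dec (lookup x i Fin.≟ lookup a i)

  Flat-free : ∀ {n F a} {x : Vec (Fin p) n} {c d} → Flat F a x → Flat (inside ∷ F) (c ∷ a) (d ∷ x)
  Flat-free x∈ zero 0∉ = contradiction Vec.here 0∉
  Flat-free x∈ (suc i) i∉ = x∈ i (i∉ ∘ Vec.there)

  Flat-fixed : ∀ {n F a} {x : Vec (Fin p) n} {c} → Flat F a x → Flat (outside ∷ F) (c ∷ a) (c ∷ x)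
  Flat-fixed x∈ zero 0∉ = refl
  Flat-fixed x∈ (suc i) i∉ = x∈ i (i∉ ∘ Vec.there)

  Flat-tail : ∀ {n F a s} {x : Vec (Fin p) n} {c d} → Flat (s ∷ F) (c ∷ a) (d ∷ x) → Flat F a x
  Flat-tail x∈ i i∉ = x∈ (suc i) (i∉ ∘ drop-there)

  Flat-head : ∀ {n F a} {x : Vec (Fin p) n} {c d} → Flat (outside ∷ F) (c ∷ a) (d ∷ x) → d ≡ c
  Flat-head x∈ = x∈ zero λ ()

  #-flat : ∀ {n} F (a : Vec (Fin p) n) → # (flat? F a) ≡ p ^ ∣ F ∣
  #-flat [] [] = refl
  #-flat (inside ∷ F) (c ∷ a) = trans
    (fibres-p (flat? (inside ∷ F) (c ∷ a)) (flat? F a) (λ _ _ → Flat-free) (λ _ _ → Flat-tail))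
    (cong (p ℕ.*_) (#-flat F a))
  #-flat (outside ∷ F) (c ∷ a) = trans
    (fibres-1 (flat? (outside ∷ F) (c ∷ a)) (flat? F a)
      (λ y y∈ → c , Flat-fixed y∈ , Flat-head) (λ _ _ → Flat-tail))
    (#-flat F a)

module _ {p : ℕ} .{{_ : NonZero p}} where

  -- The vectors whose entries in F are zero.
  ZeroOn : ∀ {n} → Subset n → Pred (Vec (Fin p) n) 0ℓ
  ZeroOn F u = ∀ i → i ∈ F → lookup u i ≡ 0ₚ

  zeroOn? : ∀ {n} (F : Subset n) → Decidable (ZeroOn F)
  zeroOn? F u = Fin.all? λ i → (i ∈? F) →-dec (lookup u i Fin.≟ 0ₚ)

  -- On a flat in whose free coordinates u vanishes, u · x is constant.
  dot-flat : ∀ {n} F (a u x : Vec (Fin p) n) → ZeroOn F u → Flat F a x → u · x ≡ u · a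
  dot-flat [] [] [] [] _ _ = refl
  dot-flat (inside ∷ F) (a ∷ as) (u ∷ us) (x ∷ xs) u0 x∈ = cong₂ _+ₚ_
    (subst (λ u → u *ₚ x ≡ u *ₚ a) (sym (u0 zero Vec.here))
           (trans (*ₚ-zeroˡ x) (sym (*ₚ-zeroˡ a))))
    (dot-flat F as us xs (λ i → u0 (suc i) ∘ Vec.there) (Flat-tail x∈))
  dot-flat (outside ∷ F) (a ∷ as) (u ∷ us) (x ∷ xs) u0 x∈ = cong₂ _+ₚ_
    (cong (u *ₚ_) (Flat-head x∈))
    (dot-flat F as us xs (λ i → u0 (suc i) ∘ Vec.there) (Flat-tail x∈))

  -- The solutions of r + t · x = 0; a hyperplane if t is nonzero.  The constant r is what
  -- an equation acquires when a coordinate of x is fixed.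
  Hyperplane : ∀ {n} → Fin p → Vec (Fin p) n → Pred (Vec (Fin p) n) 0ℓ
  Hyperplane r t x = r +ₚ t · x ≡ 0ₚ

  hyperplane? : ∀ {n} r (t : Vec (Fin p) n) → Decidable (Hyperplane r t)
  hyperplane? r t x = (r +ₚ t · x) Fin.≟ 0ₚ

  flatSection? : ∀ {n} F (a : Vec (Fin p) n) r t → Decidable (Flat F a ∩ Hyperplane r t)
  flatSection? F a r t = flat? F a ∩? hyperplane? r t

  -- If t does not vanish on the free coordinates F, each value of t · x is taken equally
  -- often on the flat.  The induction descends to a free coordinate where t is nonzero;
  -- there the equation has one solution for every choice of the later coordinates.
  p*#-flatSection : Prime p → ∀ {n} F (a : Vec (Fin p) n) r t → ¬ ZeroOn F t →
                     p ℕ.* # (flatSection? F a r t) ≡ p ^ ∣ F ∣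
  p*#-flatSection p-prime [] [] r [] t≢0 = contradiction (λ i ()) t≢0
  p*#-flatSection p-prime (outside ∷ F) (c ∷ a) r (t₀ ∷ t) t≢0 = trans
    (cong (p ℕ.*_)
      (fibres-1 (flatSection? (outside ∷ F) (c ∷ a) r (t₀ ∷ t)) (flatSection? F a r+t₀c t)
        (λ y (y∈ , eq) →
          c , (Flat-fixed y∈ , trans (sym (+ₚ-assoc r (t₀ *ₚ c) (t · y))) eq) ,
          λ (b∈ , _) → Flat-head b∈)
        (λ b y (b∈ , eq) → Flat-tail b∈ ,
          trans (+ₚ-assoc r (t₀ *ₚ c) (t · y))
                (subst (λ d → r +ₚ (t₀ *ₚ d +ₚ t · y) ≡ 0ₚ) (Flat-head b∈) eq))))
    (p*#-flatSection p-prime F a r+t₀c t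
      (λ z → t≢0 λ { (suc i) (Vec.there i∈) → z i i∈ }))
    where r+t₀c = r +ₚ t₀ *ₚ c
  p*#-flatSection p-prime (inside ∷ F) (c ∷ a) r (t₀ ∷ t) t≢0 with t₀ Fin.≟ 0ₚ
  ... | no t₀≢0 = cong (p ℕ.*_) (trans
    (fibres-1 (flatSection? (inside ∷ F) (c ∷ a) r (t₀ ∷ t)) (flat? F a)
      (λ y y∈ → let d , root , only = affine-root p-prime r (t · y) t₀≢0 in
        d , (Flat-free y∈ , root) , λ (_ , root′) → only root′)
      (λ b y (b∈ , _) → Flat-tail b∈))
    (#-flat F a))
  ... | yes refl = cong (p ℕ.*_) (trans
    (fibres-p (flatSection? (inside ∷ F) (c ∷ a) r (0ₚ ∷ t)) (flatSection? F a r t)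
      (λ d y (y∈ , eq) → Flat-free y∈ , trans (drop₀ d y) eq)
      (λ d y (y∈ , eq) → Flat-tail y∈ , trans (sym (drop₀ d y)) eq))
    (p*#-flatSection p-prime F a r t
      (λ z → t≢0 λ { zero _ → refl ; (suc i) (Vec.there i∈) → z i i∈ })))
    where
    drop₀ : ∀ d y → r +ₚ (0ₚ *ₚ d +ₚ t · y) ≡ r +ₚ t · y
    drop₀ d y = cong (r +ₚ_) (trans (cong (_+ₚ t · y) (*ₚ-zeroˡ d)) (+ₚ-identityˡ (t · y)))

module _ {p n : ℕ} {P Q R : Pred (Vec (Fin p) n) 0ℓ} where

  private
    i≡i+j-j : ∀ i j → i ≡ i + j - j
    i≡i+j-j = ℤ-Solver.solve-∀

  -- The lemmas take a decision procedure for the difference, union or intersection as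
  -- an argument, so that these sets may be given by any equivalent predicate.

  card-∖ : (P? : Decidable P) (Q? : Decidable Q) (R? : Decidable R) →
           Q ⊆ P → R ≐ P ∩ ∁ᵖ Q → card R? ≡ card P? - card Q?
  card-∖ P? Q? R? Q⊆P (R⊆ , ⊆R) = begin
    card R?                      ≡⟨ i≡i+j-j (card R?) (card Q?) ⟩
    card R? + card Q? - card Q?  ≡⟨ cong (λ k → (+ k) - card Q?) sum ⟩
    card P? - card Q?            ∎
    where
    open ≡-Reasoning
    none? : Decidable (R ∩ Q)
    none? = R? ∩? Q?
    split : ∀ {x} → P x → (R ∪ Q) x
    split {x} px with Q? x
    ... | yes q = inj₂ q
    ... | no ¬q = inj₁ (⊆R (px , ¬q))
    sum : # R? ℕ.+ # Q? ≡ # P?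
    sum = trans
      (sym (count-∪-∩ R? Q? P? none? (split , Sum.[ proj₁ ∘ R⊆ , Q⊆P ])
                      ((λ t → t) , (λ t → t)) (allVecs p n)))
      (trans (cong (λ k → # P? ℕ.+ k)
                   (count-none none? (λ x (r , q) → proj₂ (R⊆ r) q) (allVecs p n)))
             (ℕ.+-identityʳ _))

  card-∪ : {S : Pred (Vec (Fin p) n) 0ℓ}
           (P? : Decidable P) (Q? : Decidable Q) (R? : Decidable R) (S? : Decidable S) →
           R ≐ P ∪ Q → S ≐ P ∩ Q → card R? ≡ card P? + card Q? - card S?
  card-∪ P? Q? R? S? R≐ S≐ = begin
    card R?                      ≡⟨ i≡i+j-j (card R?) (card S?) ⟩
    card R? + card S? - card S?  ≡⟨ cong (λ k → (+ k) - card S?)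
                                         (count-∪-∩ P? Q? R? S? R≐ S≐ (allVecs p n)) ⟩
    card P? + card Q? - card S?  ∎
    where open ≡-Reasoning

module _ {p n : ℕ} where

  #-cong : {P Q : Pred (Vec (Fin p) n) 0ℓ} (P? : Decidable P) (Q? : Decidable Q) →
           P ≐ Q → # P? ≡ # Q?
  #-cong P? Q? P≐Q = count-cong P? Q? P≐Q (allVecs p n)

  card-∩∁ : {P Q : Pred (Vec (Fin p) n) 0ℓ} (P? : Decidable P) (Q? : Decidable Q) →
            card (P? ∩? ∁? Q?) ≡ card P? - card (P? ∩? Q?)
  card-∩∁ P? Q? = card-∖ P? (P? ∩? Q?) (P? ∩? ∁? Q?) proj₁
    ((λ (px , ¬qx) → px , ¬qx ∘ proj₂) , (λ (px , ¬pq) → px , λ qx → ¬pq (px , qx)))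

  -- Here R is the difference of P and a subset Q of P.
  hasSize-∖ : {P Q R : Pred (Vec (Fin p) n) 0ℓ} {k : ℤ} →
              (P? : Decidable P) (Q? : Decidable Q) → Q ⊆ P →
              (∀ u → R u → P u × ¬ Q u) → (∀ u → P u → ¬ Q u → R u) →
              card P? - card Q? ≡ k → HasSize R k
  hasSize-∖ P? Q? Q⊆P R⇒ ⇒R eq =
    filter P∖Q? (allVecs p n) ,
    Unique.filter⁺ P∖Q? (allVecs-unique p n) ,
    (λ u → mk⇔ (λ u∈ → let pu , ¬qu = proj₂ (∈-filter⁻ P∖Q? {xs = allVecs p n} u∈)
                       in ⇒R u pu ¬qu)
               (λ ru → ∈-filter⁺ P∖Q? (∈-allVecs u) (R⇒ u ru))) ,
    trans (card-∖ P? Q? P∖Q? Q⊆P ((λ r → r) , (λ r → r))) eq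
    where P∖Q? = P? ∩? ∁? Q?

lookup-ext : ∀ {A : Set} {n} {x y : Vec A n} → (∀ i → lookup x i ≡ lookup y i) → x ≡ y
lookup-ext {x = x} {y} eq =
  trans (sym (Vec.tabulate∘lookup x)) (trans (Vec.tabulate-cong eq) (Vec.tabulate∘lookup y))

module _ {p : ℕ} .{{_ : NonZero p}} where

  nonzeroDot? : ∀ {n} (u : Vec (Fin p) n) → Decidable (λ x → u · x ≢ 0ₚ)
  nonzeroDot? u x = ¬? ((u · x) Fin.≟ 0ₚ)

  #-flat-hyperplane : Prime p → ∀ {n} F (a t : Vec (Fin p) n) {k} →
                      ¬ ZeroOn F t → ∣ F ∣ ≡ suc k →
                      # (flatSection? F a 0ₚ t) ≡ p ^ k
  #-flat-hyperplane p-prime F a t t≢0 ∣F∣≡ =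
    ℕ.*-cancelˡ-≡ _ _ p (trans (p*#-flatSection p-prime F a 0ₚ t t≢0) (cong (p ^_) ∣F∣≡))

  -- The number of x in a flat with u · x nonzero: the equidistributed case and the two
  -- constant ones.

  card-flat-nonzeroDot : Prime p → ∀ {n} F (a u : Vec (Fin p) n) {k} →
                         ¬ ZeroOn F u → ∣ F ∣ ≡ suc k →
                         card (flat? F a ∩? nonzeroDot? u) ≡ (+ p - 1ℤ) * (+ (p ^ k))
  card-flat-nonzeroDot p-prime F a u {k} u≢0 ∣F∣≡ = begin
    card (flat? F a ∩? nonzeroDot? u)
      ≡⟨ card-∖ (flat? F a) (flatSection? F a 0ₚ u) (flat? F a ∩? nonzeroDot? u) proj₁
           ((λ (x∈ , nz) → x∈ , λ (_ , z) → nz (trans (sym (+ₚ-identityˡ _)) z)) ,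
            (λ (x∈ , ¬z) → x∈ , λ z → ¬z (x∈ , trans (+ₚ-identityˡ _) z))) ⟩
    card (flat? F a) - card (flatSection? F a 0ₚ u)
      ≡⟨ cong₂ (λ i j → (+ i) - (+ j)) (trans (#-flat F a) (cong (p ^_) ∣F∣≡))
                                       (#-flat-hyperplane p-prime F a u u≢0 ∣F∣≡) ⟩
    (+ (p ℕ.* p ^ k)) - (+ (p ^ k))
      ≡⟨ cong (_- (+ (p ^ k))) (ℤ.pos-* p (p ^ k)) ⟩
    (+ p) * (+ (p ^ k)) - (+ (p ^ k))
      ≡⟨ factor (+ p) (+ (p ^ k)) ⟩
    (+ p - 1ℤ) * (+ (p ^ k))
      ∎
    where
    open ≡-Reasoning
    factor : ∀ a b → a * b - b ≡ (a - 1ℤ) * b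
    factor = ℤ-Solver.solve-∀

  card-flat-zeroDot : ∀ {n} F (a u : Vec (Fin p) n) → ZeroOn F u → u · a ≡ 0ₚ →
                       card (flat? F a ∩? nonzeroDot? u) ≡ 0ℤ
  card-flat-zeroDot F a u u≡0 ua≡0 = cong +_ (count-none (flat? F a ∩? nonzeroDot? u)
    (λ x (x∈ , ux≢0) → ux≢0 (trans (dot-flat F a u x u≡0 x∈) ua≡0)) (allVecs p _))

  card-flat-constDot : ∀ {n} F (a u : Vec (Fin p) n) → ZeroOn F u → u · a ≢ 0ₚ →
                        card (flat? F a ∩? nonzeroDot? u) ≡ + (p ^ ∣ F ∣)
  card-flat-constDot F a u u≡0 ua≢0 = cong +_ (trans
    (count-cong (flat? F a ∩? nonzeroDot? u) (flat? F a)
      (proj₁ , λ {x} x∈ → x∈ , λ ux≡0 → ua≢0 (trans (sym (dot-flat F a u x u≡0 x∈)) ux≡0))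
      (allVecs p _))
    (#-flat F a))

  ZeroOn≐Flat : ∀ {n} (F : Subset n) → ZeroOn F ≐ Flat (∁ F) (0ᵛ {p})
  ZeroOn≐Flat F =
    (λ z i i∉ → trans (z i (x∉∁p⇒x∈p i∉)) (sym (Vec.lookup-replicate i 0ₚ))) ,
    (λ f i i∈ → trans (f i (x∈p⇒x∉∁p i∈)) (Vec.lookup-replicate i 0ₚ))

  #-zeroOn : ∀ {n} (F : Subset n) → # (zeroOn? {p} F) ≡ p ^ (n ∸ ∣ F ∣)
  #-zeroOn F = trans
    (#-cong (zeroOn? F) (flat? (∁ F) 0ᵛ)
      ((λ {u} → proj₁ (ZeroOn≐Flat F) {u}) , (λ {u} → proj₂ (ZeroOn≐Flat F) {u})))
    (trans (#-flat (∁ F) 0ᵛ) (cong (p ^_) (∣∁p∣≡n∸∣p∣ F)))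

  Flat-⊤ : ∀ {n} (a x : Vec (Fin p) n) → Flat ⊤ a x
  Flat-⊤ a x i i∉ = contradiction ∈⊤ i∉

  #-U : ∀ n → # (U? {A = Vec (Fin p) n}) ≡ p ^ n
  #-U n = trans
    (#-cong (U? {A = Vec (Fin p) n}) (flat? ⊤ 0ᵛ) ((λ {x} _ → Flat-⊤ 0ᵛ x) , (λ _ → tt)))
    (trans (#-flat (⊤ {n}) 0ᵛ) (cong (p ^_) (∣⊤∣≡n n)))

  ZeroOn-⊤ : ∀ {n} (u : Vec (Fin p) n) → ZeroOn ⊤ u → u ≡ 0ᵛ
  ZeroOn-⊤ u z = lookup-ext λ i → trans (z i ∈⊤) (sym (Vec.lookup-replicate i 0ₚ))

  ZeroOn-0ᵛ : ∀ {n} (F : Subset n) → ZeroOn F (0ᵛ {p})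
  ZeroOn-0ᵛ F i _ = Vec.lookup-replicate i 0ₚ

  card-nonzeroDot : Prime p → ∀ {n k} (u : Vec (Fin p) n) → n ≡ suc k → u ≢ 0ᵛ →
                 card (nonzeroDot? u) ≡ (+ p - 1ℤ) * (+ (p ^ k))
  card-nonzeroDot p-prime {n} u n≡ u≢0 = trans
    (cong +_ (#-cong (nonzeroDot? u) (flat? ⊤ 0ᵛ ∩? nonzeroDot? u)
      ((λ {x} nz → Flat-⊤ 0ᵛ x , nz) , proj₂)))
    (card-flat-nonzeroDot p-prime ⊤ 0ᵛ u (u≢0 ∘ ZeroOn-⊤ u) (trans (∣⊤∣≡n n) n≡))

------------------------------------------------------------------------
-- The subset [m] and the set of saturated ideals

∣p∪q∣≡∣p∣+∣q∣ : ∀ {n} (P Q : Subset n) → (∀ i → i ∈ P → i ∉ Q) →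
                ∣ P ∪ˢ Q ∣ ≡ ∣ P ∣ ℕ.+ ∣ Q ∣
∣p∪q∣≡∣p∣+∣q∣ [] [] _ = refl
∣p∪q∣≡∣p∣+∣q∣ (inside ∷ P) (inside ∷ Q) disj = contradiction Vec.here (disj zero Vec.here)
∣p∪q∣≡∣p∣+∣q∣ (inside ∷ P) (outside ∷ Q) disj =
  cong suc (∣p∪q∣≡∣p∣+∣q∣ P Q λ i i∈P → disj (suc i) (Vec.there i∈P) ∘ Vec.there)
∣p∪q∣≡∣p∣+∣q∣ (outside ∷ P) (inside ∷ Q) disj = trans
  (cong suc (∣p∪q∣≡∣p∣+∣q∣ P Q λ i i∈P → disj (suc i) (Vec.there i∈P) ∘ Vec.there))
  (sym (ℕ.+-suc ∣ P ∣ ∣ Q ∣))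
∣p∪q∣≡∣p∣+∣q∣ (outside ∷ P) (outside ∷ Q) disj =
  ∣p∪q∣≡∣p∣+∣q∣ P Q λ i i∈P → disj (suc i) (Vec.there i∈P) ∘ Vec.there

-- The subset [m] of [n], all of it if m exceeds n.
initial : (m n : ℕ) → Subset n
initial m zero = []
initial zero (suc n) = outside ∷ initial zero n
initial (suc m) (suc n) = inside ∷ initial m n

∈-initial⁺ : ∀ {m n} {i : Fin n} → toℕ i < m → i ∈ initial m n
∈-initial⁺ {suc m} {suc n} {zero} _ = Vec.here
∈-initial⁺ {suc m} {suc n} {suc i} (s≤s i<m) = Vec.there (∈-initial⁺ i<m)

∈-initial⁻ : ∀ {m n} {i : Fin n} → i ∈ initial m n → toℕ i < m
∈-initial⁻ {suc m} {suc n} {zero} _ = s≤s z≤n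
∈-initial⁻ {zero} {suc n} {suc i} (Vec.there i∈) = contradiction (∈-initial⁻ {zero} i∈) λ ()
∈-initial⁻ {suc m} {suc n} {suc i} (Vec.there i∈) = s≤s (∈-initial⁻ i∈)

∣initial∣ : ∀ {m n} → m ≤ n → ∣ initial m n ∣ ≡ m
∣initial∣ {zero} {zero} _ = refl
∣initial∣ {zero} {suc n} _ = ∣initial∣ {zero} {n} z≤n
∣initial∣ {suc m} {suc n} (s≤s m≤n) = cong suc (∣initial∣ m≤n)

module _ {p : ℕ} .{{_ : NonZero p}} where

  -- The 0-1 vector of a subset.
  indicator : ∀ {n} → Subset n → Vec (Fin p) n
  indicator = Vec.map (λ s → if s then 1ₚ else 0ₚ)

  lookup-indicator-∈ : ∀ {n} {F : Subset n} {i} → i ∈ F → lookup (indicator F) i ≡ 1ₚ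
  lookup-indicator-∈ Vec.here = refl
  lookup-indicator-∈ {F = _ ∷ F} (Vec.there i∈) = lookup-indicator-∈ {F = F} i∈

  lookup-indicator-∉ : ∀ {n} {F : Subset n} {i} → i ∉ F → lookup (indicator F) i ≡ 0ₚ
  lookup-indicator-∉ {F = inside ∷ F} {zero} i∉ = contradiction Vec.here i∉
  lookup-indicator-∉ {F = outside ∷ F} {zero} i∉ = refl
  lookup-indicator-∉ {F = _ ∷ F} {suc i} i∉ = lookup-indicator-∉ (i∉ ∘ Vec.there)

  dot-0ˡ : ∀ {n} (x : Vec (Fin p) n) → 0ᵛ · x ≡ 0ₚ
  dot-0ˡ [] = refl
  dot-0ˡ (a ∷ x) = trans (cong₂ _+ₚ_ (*ₚ-zeroˡ a) (dot-0ˡ x)) (+ₚ-identityˡ 0ₚ)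

  -- For u = (v , w), the sum of v is the product of u with the 0-1 vector of [m].
  sum-truncate : ∀ {m n} (m≤n : m ≤ n) (u : Vec (Fin p) n) →
                 sumₚ (Vec.truncate m≤n u) ≡ indicator (initial m n) · u
  sum-truncate {zero} {zero} _ [] = refl
  sum-truncate {zero} {suc n} _ (a ∷ u) = sym (trans
    (cong₂ _+ₚ_ (*ₚ-zeroˡ a) (sym (sum-truncate {zero} {n} z≤n u))) (+ₚ-identityˡ 0ₚ))
  sum-truncate {suc m} {suc n} (s≤s m≤n) (a ∷ u) =
    cong₂ _+ₚ_ (sym (*ₚ-identityˡ a)) (sum-truncate m≤n u)

  truncate-zero⁺ : ∀ {m n} (m≤n : m ≤ n) (u : Vec (Fin p) n) →
                   ZeroOn (initial m n) u → Vec.truncate m≤n u ≡ 0ᵛ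
  truncate-zero⁺ {zero} _ u z = refl
  truncate-zero⁺ {suc m} (s≤s m≤n) (a ∷ u) z =
    cong₂ _∷_ (z zero Vec.here) (truncate-zero⁺ m≤n u (λ i i∈ → z (suc i) (Vec.there i∈)))

  truncate-zero⁻ : ∀ {m n} (m≤n : m ≤ n) (u : Vec (Fin p) n) →
                   Vec.truncate m≤n u ≡ 0ᵛ → ZeroOn (initial m n) u
  truncate-zero⁻ {zero} _ u eq i i∈ = contradiction (∈-initial⁻ i∈) λ ()
  truncate-zero⁻ {suc m} (s≤s m≤n) (a ∷ u) eq zero i∈ = Vec.∷-injectiveˡ eq
  truncate-zero⁻ {suc m} (s≤s m≤n) (a ∷ u) eq (suc i) (Vec.there i∈) =
    truncate-zero⁻ m≤n u (Vec.∷-injectiveʳ eq) i i∈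

  module _ (1<p : 1 < p) {m n : ℕ} (B : Subset n) (m≤B : ∀ i → i ∈ B → m ≤ toℕ i) where

    private
      M : Subset n
      M = initial m n

      ideals? : Decidable (IdealsIn (ℍ m n) (fullIdeal m B))
      ideals? = idealsIn? (ℍ? m n) (fullIdeal m B)

    -- The vector that is -1 on [m] and 0 elsewhere.
    top : Vec (Fin p) n
    top = -1ₚ *ᵛ indicator M

    private
      lookup-top-∈ : ∀ {i} → i ∈ M → lookup top i ≡ -1ₚ
      lookup-top-∈ {i} i∈ = trans (Vec.lookup-map i (-1ₚ *ₚ_) (indicator M))
        (trans (cong (-1ₚ *ₚ_) (lookup-indicator-∈ i∈)) (*ₚ-identityʳ -1ₚ))

      lookup-top-∉ : ∀ {i} → i ∉ M → lookup top i ≡ 0ₚ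
      lookup-top-∉ {i} i∉ = trans (Vec.lookup-map i (-1ₚ *ₚ_) (indicator M))
        (trans (cong (-1ₚ *ₚ_) (lookup-indicator-∉ i∉)) (*ₚ-zeroʳ -1ₚ))

      lookup-full-∈ : ∀ {i} → i ∈ M ⊎ i ∈ B → lookup (fullIdeal m B) i ≡ -1ₚ
      lookup-full-∈ {i} i∈ = trans (Vec.lookup∘tabulate _ i)
        (cong (if_then -1ₚ else 0ₚ)
          (dec-true ((toℕ i <? m) ⊎-dec (i ∈? B)) (Sum.map₁ ∈-initial⁻ i∈)))

      lookup-full-∉ : ∀ {i} → i ∉ M → i ∉ B → lookup (fullIdeal m B) i ≡ 0ₚ
      lookup-full-∉ {i} i∉M i∉B = trans (Vec.lookup∘tabulate _ i)
        (cong (if_then -1ₚ else 0ₚ)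
          (dec-false ((toℕ i <? m) ⊎-dec (i ∈? B)) Sum.[ i∉M ∘ ∈-initial⁺ , i∉B ]))

      ∉M⇒≥ : ∀ {i : Fin n} → i ∉ M → m ≤ toℕ i
      ∉M⇒≥ i∉ = ℕ.≮⇒≥ (i∉ ∘ ∈-initial⁺)

      ≥⇒∉M : ∀ {i : Fin n} → m ≤ toℕ i → i ∉ M
      ≥⇒∉M m≤i i∈ = ℕ.<⇒≱ (∈-initial⁻ i∈) m≤i

      ∈M⇒∉B : ∀ {i : Fin n} → i ∈ M → i ∉ B
      ∈M⇒∉B i∈M i∈B = ≥⇒∉M (m≤B _ i∈B) i∈M

      ≤0ₚ⇒≡0ₚ : ∀ {a b : Fin p} → a Fin.≤ b → b ≡ 0ₚ → a ≡ 0ₚ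
      ≤0ₚ⇒≡0ₚ a≤b refl = toℕ≡0⇒≡0ₚ (ℕ.n≤0⇒n≡0 (ℕ.≤-trans a≤b (ℕ.≤-reflexive toℕ-0ₚ)))

      ≡0ₚ⇒≤ : ∀ {a b : Fin p} → a ≡ 0ₚ → a Fin.≤ b
      ≡0ₚ⇒≤ refl = ℕ.≤-trans (ℕ.≤-reflexive toℕ-0ₚ) z≤n

      ≤-1ₚ : ∀ {a b : Fin p} → b ≡ -1ₚ → a Fin.≤ b
      ≤-1ₚ {a} refl = ℕ.≤-trans (ℕ.∸-monoˡ-≤ 1 (Fin.toℕ<n a)) (ℕ.≤-reflexive (sym toℕ--1ₚ))

    -- A saturated ideal with an element j outside [m] is full on [m]; one without is
    -- supported in [m].
    idealsIn-fullIdeal : IdealsIn (ℍ m n) (fullIdeal m B) ≐ Flat M 0ᵛ ∪ Flat B top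
    idealsIn-fullIdeal = (λ {J} → to J) , λ {J} → Sum.[ from₁ J , from₂ J ]
      where
      to : ∀ J → IdealsIn (ℍ m n) (fullIdeal m B) J → (Flat M 0ᵛ ∪ Flat B top) J
      to J ((_ , saturated) , J⊆I)
        with Fin.any? (λ j → (m ≤? toℕ j) ×-dec ¬? (lookup J j Fin.≟ 0ₚ))
      ... | no none = inj₁ λ i i∉M → trans
              (decidable-stable (lookup J i Fin.≟ 0ₚ) (λ Ji≢0 → none (i , ∉M⇒≥ i∉M , Ji≢0)))
              (sym (Vec.lookup-replicate i 0ₚ))
      ... | yes (j , m≤j , Jj≢0) = inj₂ agree
        where
        agree : Flat B top J
        agree i i∉B with i ∈? M
        ... | yes i∈M = trans
                (Fin.toℕ-injective (trans
                  (saturated i j (∈-initial⁻ i∈M , m≤j) (Jj≢0 ∘ toℕ≡0⇒≡0ₚ)) (sym toℕ--1ₚ)))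
                (sym (lookup-top-∈ i∈M))
        ... | no i∉M = trans (≤0ₚ⇒≡0ₚ (J⊆I i) (lookup-full-∉ i∉M i∉B)) (sym (lookup-top-∉ i∉M))

      from₁ : ∀ J → Flat M 0ᵛ J → IdealsIn (ℍ m n) (fullIdeal m B) J
      from₁ J J∈ = ((λ i j (_ , m≤j) j∈ → contradiction (vanishes j m≤j) j∈) ,
                    (λ i j (_ , m≤j) j∈ → contradiction (vanishes j m≤j) j∈)) , below
        where
        zero-off-M : ∀ i → i ∉ M → lookup J i ≡ 0ₚ
        zero-off-M i i∉M = trans (J∈ i i∉M) (Vec.lookup-replicate i 0ₚ)
        vanishes : ∀ j → m ≤ toℕ j → toℕ (lookup J j) ≡ 0
        vanishes j m≤j = trans (cong toℕ (zero-off-M j (≥⇒∉M m≤j))) toℕ-0ₚ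
        below : J ⊆ᵐ fullIdeal m B
        below i with i ∈? M
        ... | yes i∈M = ≤-1ₚ (lookup-full-∈ (inj₁ i∈M))
        ... | no i∉M = ≡0ₚ⇒≤ (zero-off-M i i∉M)

      from₂ : ∀ J → Flat B top J → IdealsIn (ℍ m n) (fullIdeal m B) J
      from₂ J J∈ = ((λ i j (i<m , _) _ Ji≡0 → p-1≢0 (trans (sym (full i i<m)) Ji≡0)) ,
                    (λ i j (i<m , _) _ → full i i<m)) , below
        where
        p-1≢0 : p ∸ 1 ≢ 0
        p-1≢0 = ℕ.m>n⇒m∸n≢0 1<p
        full : ∀ i → toℕ i < m → toℕ (lookup J i) ≡ p ∸ 1
        full i i<m = trans
          (cong toℕ (trans (J∈ i (∈M⇒∉B (∈-initial⁺ i<m))) (lookup-top-∈ (∈-initial⁺ i<m))))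
          toℕ--1ₚ
        below : J ⊆ᵐ fullIdeal m B
        below i with i ∈? M | i ∈? B
        ... | yes i∈M | _ = ≤-1ₚ (lookup-full-∈ (inj₁ i∈M))
        ... | no i∉M | yes i∈B = ≤-1ₚ (lookup-full-∈ (inj₂ i∈B))
        ... | no i∉M | no i∉B = ≡0ₚ⇒≤ (trans (J∈ i i∉B) (lookup-top-∉ i∉M))

    flats-meet : Flat ⊥ top ≐ Flat M 0ᵛ ∩ Flat B top
    flats-meet =
      (λ x∈ → (λ i i∉M → trans (x∈ i ∉⊥)
                 (trans (lookup-top-∉ i∉M) (sym (Vec.lookup-replicate i 0ₚ)))) ,
              (λ i _ → x∈ i ∉⊥)) ,
      (λ {x} → from x)
      where
      from : ∀ x → (Flat M 0ᵛ ∩ Flat B top) x → Flat ⊥ top x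
      from x (x∈₁ , x∈₂) i _ with i ∈? M
      ... | yes i∈M = x∈₂ i (∈M⇒∉B i∈M)
      ... | no i∉M = trans (x∈₁ i i∉M) (trans (Vec.lookup-replicate i 0ₚ) (sym (lookup-top-∉ i∉M)))

    -- The points of the defining set that satisfy N, by inclusion and exclusion.
    card-definingSet : ∀ {N : Pred (Vec (Fin p) n) 0ℓ} (N? : Decidable N) →
      card (definingSet? m B ∩? N?) ≡
      card N? - (card (flat? M 0ᵛ ∩? N?) + card (flat? B top ∩? N?) - card (flat? ⊥ top ∩? N?))
    card-definingSet N? = trans
      (card-∖ N? (ideals? ∩? N?) (definingSet? m B ∩? N?) proj₂
        ((λ (d , x∈) → x∈ , λ (x∈I , _) → d x∈I) ,
         (λ (x∈ , ¬I) → (λ x∈I → ¬I (x∈I , x∈)) , x∈)))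
      (cong (λ k → card N? - k)
        (card-∪ (flat? M 0ᵛ ∩? N?) (flat? B top ∩? N?) (ideals? ∩? N?) (flat? ⊥ top ∩? N?)
          ((λ {x} (x∈I , x∈) → Sum.map (_, x∈) (_, x∈) (proj₁ idealsIn-fullIdeal {x} x∈I)) ,
           (λ {x} → Sum.[ (λ (x∈₁ , x∈) → proj₂ idealsIn-fullIdeal {x} (inj₁ x∈₁) , x∈) ,
                          (λ (x∈₂ , x∈) → proj₂ idealsIn-fullIdeal {x} (inj₂ x∈₂) , x∈) ]))
          ((λ {x} (x∈⊥ , x∈) → let x∈₁ , x∈₂ = proj₁ flats-meet {x} x∈⊥
                               in (x∈₁ , x∈) , (x∈₂ , x∈)) ,
           (λ {x} ((x∈₁ , x∈) , (x∈₂ , _)) → proj₂ flats-meet {x} (x∈₁ , x∈₂) , x∈))))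

------------------------------------------------------------------------
-- Linear codes from defining sets

module _ {p : ℕ} .{{_ : NonZero p}} where

  dot-+ˡ : ∀ {n} (u v x : Vec (Fin p) n) → (u +ᵛ v) · x ≡ u · x +ₚ v · x
  dot-+ˡ [] [] [] = sym (+ₚ-identityˡ 0ₚ)
  dot-+ˡ (a ∷ u) (b ∷ v) (c ∷ x) = trans (cong₂ _+ₚ_ (*ₚ-distribʳ-+ₚ c a b) (dot-+ˡ u v x))
    (Consequences.comm∧assoc⇒middleFour +ₚ-comm +ₚ-assoc (a *ₚ c) (b *ₚ c) (u · x) (v · x))

  dot-*ˡ : ∀ {n} a (u x : Vec (Fin p) n) → (a *ᵛ u) · x ≡ a *ₚ (u · x)
  dot-*ˡ a [] [] = sym (*ₚ-zeroʳ a)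
  dot-*ˡ a (b ∷ u) (c ∷ x) =
    trans (cong₂ _+ₚ_ (*ₚ-assoc a b c) (dot-*ˡ a u x))
          (sym (*ₚ-distribˡ-+ₚ a (b *ₚ c) (u · x)))

  dot-comm : ∀ {n} (u x : Vec (Fin p) n) → u · x ≡ x · u
  dot-comm [] [] = refl
  dot-comm (a ∷ u) (b ∷ x) = cong₂ _+ₚ_ (*ₚ-comm a b) (dot-comm u x)

  dot-*ʳ : ∀ {n} a (u x : Vec (Fin p) n) → u · (a *ᵛ x) ≡ a *ₚ (u · x)
  dot-*ʳ a u x = trans (dot-comm u (a *ᵛ x)) (trans (dot-*ˡ a x u) (cong (a *ₚ_) (dot-comm x u)))

  dot-+ʳ : ∀ {n} (u x y : Vec (Fin p) n) → u · (x +ᵛ y) ≡ u · x +ₚ u · y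
  dot-+ʳ u x y = trans (dot-comm u (x +ᵛ y))
    (trans (dot-+ˡ x y u) (cong₂ _+ₚ_ (dot-comm x u) (dot-comm y u)))

  -- The i-th unit vector.
  unit : ∀ {n} → Fin n → Vec (Fin p) n
  unit i = 0ᵛ [ i ]≔ 1ₚ

  unit-dot : ∀ {n} i (x : Vec (Fin p) n) → unit i · x ≡ lookup x i
  unit-dot zero (a ∷ x) = trans (cong₂ _+ₚ_ (*ₚ-identityˡ a) (dot-0ˡ x)) (+ₚ-identityʳ a)
  unit-dot (suc i) (a ∷ x) = trans (cong₂ _+ₚ_ (*ₚ-zeroˡ a) (unit-dot i x)) (+ₚ-identityˡ _)

  dot-unit : ∀ {n} (u : Vec (Fin p) n) i → u · unit i ≡ lookup u i
  dot-unit u i = trans (dot-comm u (unit i)) (unit-dot i u)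

  lookup-unit-≡ : ∀ {n} (i : Fin n) → lookup (unit i) i ≡ 1ₚ
  lookup-unit-≡ i = Vec.lookup∘update i 0ᵛ 1ₚ

  lookup-unit-≢ : ∀ {n} {i j : Fin n} → j ≢ i → lookup (unit i) j ≡ 0ₚ
  lookup-unit-≢ {j = j} j≢i = trans (Vec.lookup∘update′ j≢i 0ᵛ 1ₚ) (Vec.lookup-replicate j 0ₚ)

  lookup-linComb : ∀ {k N} (as : Vec (Fin p) k) (bs : Vec (Vec (Fin p) N) k) j →
                   lookup (linComb as bs) j ≡ as · Vec.map (λ b → lookup b j) bs
  lookup-linComb [] [] j = Vec.lookup-replicate j 0ₚ
  lookup-linComb (a ∷ as) (b ∷ bs) j = trans
    (Vec.lookup-zipWith _+ₚ_ j (a *ᵛ b) (linComb as bs))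
    (cong₂ _+ₚ_ (Vec.lookup-map j (a *ₚ_) b) (lookup-linComb as bs j))

  wt-map : ∀ {A : Set} (f : A → Fin p) xs →
           wt (Vec.map f (fromList xs)) ≡ count (λ x → ¬? (f x Fin.≟ 0ₚ)) xs
  wt-map f [] = refl
  wt-map f (x ∷ xs) with f x Fin.≟ 0ₚ
  ... | yes _ = wt-map f xs
  ... | no  _ = cong suc (wt-map f xs)

  module _ {n : ℕ} {D : Pred (Vec (Fin p) n) 0ℓ} (D? : Decidable D) where

    wt-codeword : ∀ u → wt (codeword D? u) ≡ # (D? ∩? nonzeroDot? u)
    wt-codeword u = trans (wt-map (u ·_) (points D?))
      (count-filter (nonzeroDot? u) D? (allVecs p n))

    private
      point : Fin (length (points D?)) → Vec (Fin p) n
      point = lookup (fromList (points D?))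

    lookup-codeword : ∀ u j → lookup (codeword D? u) j ≡ u · point j
    lookup-codeword u j = Vec.lookup-map j (u ·_) (fromList (points D?))

    codeword-0 : codeword D? 0ᵛ ≡ 0ᵛ
    codeword-0 = lookup-ext λ j → trans (lookup-codeword 0ᵛ j)
      (trans (dot-0ˡ (point j)) (sym (Vec.lookup-replicate j 0ₚ)))

    codeword-+ : ∀ u v → codeword D? (u +ᵛ v) ≡ codeword D? u +ᵛ codeword D? v
    codeword-+ u v = lookup-ext λ j → begin
      lookup (codeword D? (u +ᵛ v)) j
        ≡⟨ lookup-codeword (u +ᵛ v) j ⟩
      (u +ᵛ v) · point j
        ≡⟨ dot-+ˡ u v (point j) ⟩
      u · point j +ₚ v · point j
        ≡⟨ cong₂ _+ₚ_ (lookup-codeword u j) (lookup-codeword v j) ⟨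
      lookup (codeword D? u) j +ₚ lookup (codeword D? v) j
        ≡⟨ Vec.lookup-zipWith _+ₚ_ j (codeword D? u) (codeword D? v) ⟨
      lookup (codeword D? u +ᵛ codeword D? v) j
        ∎
      where open ≡-Reasoning

    codeword-* : ∀ a u → codeword D? (a *ᵛ u) ≡ a *ᵛ codeword D? u
    codeword-* a u = lookup-ext λ j → begin
      lookup (codeword D? (a *ᵛ u)) j   ≡⟨ lookup-codeword (a *ᵛ u) j ⟩
      (a *ᵛ u) · point j                ≡⟨ dot-*ˡ a u (point j) ⟩
      a *ₚ (u · point j)                ≡⟨ cong (a *ₚ_) (lookup-codeword u j) ⟨
      a *ₚ lookup (codeword D? u) j     ≡⟨ Vec.lookup-map j (a *ₚ_) (codeword D? u) ⟨
      lookup (a *ᵛ codeword D? u) j     ∎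
      where open ≡-Reasoning

    Code-isLinear : IsLinear (Code D?)
    Code-isLinear =
      (0ᵛ , sym codeword-0) ,
      (λ { _ _ (u , refl) (v , refl) → u +ᵛ v , sym (codeword-+ u v) }) ,
      (λ { a _ (u , refl) → a *ᵛ u , sym (codeword-* a u) })

    -- The codewords of the unit vectors, the basis of the code.  The matrix with these
    -- rows has the points of D as its columns.
    unitCodewords : Vec (Vec (Fin p) (length (points D?))) n
    unitCodewords = tabulate λ i → codeword D? (unit i)

    linComb-unitCodewords : ∀ u → linComb u unitCodewords ≡ codeword D? u
    linComb-unitCodewords u = lookup-ext λ j → begin
      lookup (linComb u unitCodewords) j            ≡⟨ lookup-linComb u unitCodewords j ⟩
      u · Vec.map (λ b → lookup b j) unitCodewords  ≡⟨ cong (u ·_) (column j) ⟩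
      u · point j                                   ≡⟨ lookup-codeword u j ⟨
      lookup (codeword D? u) j                      ∎
      where
      open ≡-Reasoning
      column : ∀ j → Vec.map (λ b → lookup b j) unitCodewords ≡ point j
      column j = trans (sym (Vec.tabulate-∘ (λ b → lookup b j) (λ i → codeword D? (unit i))))
        (trans (Vec.tabulate-cong λ i → trans (lookup-codeword (unit i) j) (unit-dot i (point j)))
               (Vec.tabulate∘lookup (point j)))

    -- The dimension is n as soon as no nonzero u is orthogonal to all of D.
    Code-hasDimension : (∀ u → (∀ x → D x → u · x ≡ 0ₚ) → u ≡ 0ᵛ) → HasDimension (Code D?) n
    Code-hasDimension separates =
      unitCodewords ,
      VecAll.tabulate⁺ (λ i → unit i , refl) ,
      (λ u eq → separates u λ x x∈D →
        constant (points D?) (trans (sym (linComb-unitCodewords u)) eq)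
                 (∈-filter⁺ D? (∈-allVecs x) x∈D)) ,
      (λ { _ (u , refl) → u , sym (linComb-unitCodewords u) })
      where
      constant : ∀ {A : Set} {f : A → Fin p} {x} xs →
                 Vec.map f (fromList xs) ≡ 0ᵛ → x List.∈ xs → f x ≡ 0ₚ
      constant (y ∷ xs) eq (here refl) = Vec.∷-injectiveˡ eq
      constant (y ∷ xs) eq (there x∈) = constant xs (Vec.∷-injectiveʳ eq) x∈

  module _ (2<p : 2 < p) {m n : ℕ} (1≤m : 1 ≤ m) (m<n : m < n) (B : Subset n) where

    private
      1<p : 1 < p
      1<p = ℕ.<⇒≤ 2<p

      0≢-1 : 0ₚ ≢ -1ₚ {p}
      0≢-1 = -1ₚ≢0ₚ 1<p ∘ sym

      -- The first element of [m] and the first one outside it.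
      i₀ j₀ : Fin n
      i₀ = Fin.fromℕ< (ℕ.<-trans 1≤m m<n)
      j₀ = Fin.fromℕ< m<n

      i₀<m : toℕ i₀ < m
      i₀<m = subst (_< m) (sym (Fin.toℕ-fromℕ< _)) 1≤m

      i₀≢j₀ : i₀ ≢ j₀
      i₀≢j₀ eq = ℕ.<-irrefl (trans (cong toℕ eq) (Fin.toℕ-fromℕ< m<n)) i₀<m

      ∈D : ∀ x → lookup x j₀ ≢ 0ₚ → lookup x i₀ ≢ -1ₚ → definingSet m B x
      ∈D x xj≢0 xi≢-1 ((_ , saturated) , _) = xi≢-1 (Fin.toℕ-injective (trans
        (saturated i₀ j₀ (i₀<m , ℕ.≤-reflexive (sym (Fin.toℕ-fromℕ< m<n))) (xj≢0 ∘ toℕ≡0⇒≡0ₚ))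
        (sym toℕ--1ₚ)))

      unit∈D : definingSet m B (unit j₀)
      unit∈D = ∈D (unit j₀) (1ₚ≢0ₚ 1<p ∘ trans (sym (lookup-unit-≡ j₀)))
                  (0≢-1 ∘ trans (sym (lookup-unit-≢ i₀≢j₀)))

      lookup-sum : ∀ k i {a b} → lookup (unit k) i ≡ a → lookup (unit j₀) i ≡ b →
                   lookup (unit k +ᵛ unit j₀) i ≡ a +ₚ b
      lookup-sum k i refl refl = Vec.lookup-zipWith _+ₚ_ i (unit k) (unit j₀)

      sum∈D : ∀ k → k ≢ j₀ → definingSet m B (unit k +ᵛ unit j₀)
      sum∈D k k≢j = ∈D (unit k +ᵛ unit j₀) (1ₚ≢0ₚ 1<p ∘ trans (sym j₀-entry)) i₀-entry
        where
        j₀-entry : lookup (unit k +ᵛ unit j₀) j₀ ≡ 1ₚ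
        j₀-entry = trans
          (lookup-sum k j₀ (lookup-unit-≢ (k≢j ∘ sym)) (lookup-unit-≡ j₀)) (+ₚ-identityˡ 1ₚ)
        i₀-entry : lookup (unit k +ᵛ unit j₀) i₀ ≢ -1ₚ
        i₀-entry eq with i₀ Fin.≟ k
        ... | yes refl = 1ₚ≢-1ₚ 2<p (trans (sym (trans
                (lookup-sum k i₀ (lookup-unit-≡ i₀) (lookup-unit-≢ i₀≢j₀)) (+ₚ-identityʳ 1ₚ))) eq)
        ... | no i₀≢k = 0≢-1 (trans (sym (trans
                (lookup-sum k i₀ (lookup-unit-≢ i₀≢k) (lookup-unit-≢ i₀≢j₀)) (+ₚ-identityʳ 0ₚ))) eq)

    -- If u is orthogonal to e_j then u_j = 0; if also to e_k + e_j then u_k = 0.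
    definingSet-separates : ∀ u → (∀ x → definingSet m B x → u · x ≡ 0ₚ) → u ≡ 0ᵛ
    definingSet-separates u ux≡0 = lookup-ext λ k →
      trans (entry k) (sym (Vec.lookup-replicate k 0ₚ))
      where
      uj≡0 : lookup u j₀ ≡ 0ₚ
      uj≡0 = trans (sym (dot-unit u j₀)) (ux≡0 (unit j₀) unit∈D)
      entry : ∀ k → lookup u k ≡ 0ₚ
      entry k with k Fin.≟ j₀
      ... | yes refl = uj≡0
      ... | no k≢j = begin
        lookup u k                    ≡⟨ +ₚ-identityʳ (lookup u k) ⟨
        lookup u k +ₚ 0ₚ              ≡⟨ cong₂ _+ₚ_ (dot-unit u k) (trans (dot-unit u j₀) uj≡0) ⟨
        u · unit k +ₚ u · unit j₀     ≡⟨ dot-+ʳ u (unit k) (unit j₀) ⟨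
        u · (unit k +ᵛ unit j₀)       ≡⟨ ux≡0 (unit k +ᵛ unit j₀) (sum∈D k k≢j) ⟩
        0ₚ                            ∎
        where open ≡-Reasoning

------------------------------------------------------------------------
-- The parameters of the code

bit≡1⇒ : {A : Set} (d : Dec A) → (if does d then 1 else 0) ≡ 1 → A
bit≡1⇒ (yes a) _ = a

bit≡0⇒ : {A : Set} (d : Dec A) → (if does d then 1 else 0) ≡ 0 → ¬ A
bit≡0⇒ (no ¬a) _ = ¬a

-- The data of the theorem, with b = ∣ B ∣.
module WeightDistribution {p : ℕ} .{{_ : NonZero p}} (p-prime : Prime p) (2∤p : 2 ∤ p)
         {m n : ℕ} (1≤m : 1 ≤ m) (m<n : m < n)
         (B : Subset n) (m≤B : ∀ i → i ∈ B → m ≤ toℕ i)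
         (1≤b : 1 ≤ ∣ B ∣) (b≤n∸m : ∣ B ∣ ≤ n ∸ m) where

  private
    b : ℕ
    b = ∣ B ∣

    M : Subset n
    M = initial m n

    D? : Decidable (definingSet {p} m B)
    D? = definingSet? m B

    m≤n : m ≤ n
    m≤n = ℕ.<⇒≤ m<n

    1<p : 1 < p
    1<p = nonTrivial⇒n>1 p {{prime⇒nonTrivial p-prime}}

    2<p : 2 < p
    2<p = ℕ.≤∧≢⇒< 1<p λ { refl → 2∤p ∣-refl }

    v : Vec (Fin p) n → Vec (Fin p) m
    v = head[ m<n ]

    σ : Vec (Fin p) n → Fin p
    σ u = sumₚ (v u)

    -- The vectors that are 1, respectively -1, on [m] and 0 elsewhere.
    1ᴹ aᴹ : Vec (Fin p) n
    1ᴹ = indicator M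
    aᴹ = top 1<p B m≤B

    -- The sets of u with v = 0, with δ = 1 and with σ = 0.
    V Δ S : Pred (Vec (Fin p) n) 0ℓ
    V = ZeroOn M
    Δ = ZeroOn B
    S = Hyperplane 0ₚ 1ᴹ

    V? : Decidable V
    V? = zeroOn? M

    Δ? : Decidable Δ
    Δ? = zeroOn? B

    S? : Decidable S
    S? = hyperplane? 0ₚ 1ᴹ

    v⇒V : ∀ u → v u ≡ 0ᵛ → V u
    v⇒V u = truncate-zero⁻ m≤n u

    V⇒v : ∀ u → V u → v u ≡ 0ᵛ
    V⇒v u = truncate-zero⁺ m≤n u

    δ⇒Δ : ∀ u → δ B u ≡ 1 → Δ u
    δ⇒Δ u = bit≡1⇒ (Δ? u)

    Δ⇒δ : ∀ u → Δ u → δ B u ≡ 1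
    Δ⇒δ u z = cong (if_then 1 else 0) (dec-true (Δ? u) z)

    δ⇒¬Δ : ∀ u → δ B u ≡ 0 → ¬ Δ u
    δ⇒¬Δ u = bit≡0⇒ (Δ? u)

    ¬Δ⇒δ : ∀ u → ¬ Δ u → δ B u ≡ 0
    ¬Δ⇒δ u ¬z = cong (if_then 1 else 0) (dec-false (Δ? u) ¬z)

    σ≡ : ∀ u → 0ₚ +ₚ 1ᴹ · u ≡ σ u
    σ≡ u = trans (+ₚ-identityˡ (1ᴹ · u)) (sym (sum-truncate m≤n u))

    σ⇒S : ∀ u → σ u ≡ 0ₚ → S u
    σ⇒S u = trans (σ≡ u)

    S⇒σ : ∀ u → S u → σ u ≡ 0ₚ
    S⇒σ u = trans (sym (σ≡ u))

    V⇒S : ∀ u → V u → S u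
    V⇒S u z = σ⇒S u (trans (cong sumₚ (V⇒v u z)) (trans (sym (+ₚ-identityˡ _)) (sum-0 m)))
      where
      sum-0 : ∀ k → 0ₚ +ₚ sumₚ (0ᵛ {p} {k}) ≡ 0ₚ
      sum-0 zero = +ₚ-identityˡ 0ₚ
      sum-0 (suc k) = trans (+ₚ-identityˡ _) (sum-0 k)

    dot-top : ∀ u → u · aᴹ ≡ -1ₚ *ₚ σ u
    dot-top u = trans (dot-*ʳ -1ₚ u 1ᴹ)
      (cong (-1ₚ *ₚ_) (trans (dot-comm u 1ᴹ) (sym (sum-truncate m≤n u))))

    dot-top≡0 : ∀ u → σ u ≡ 0ₚ → u · aᴹ ≡ 0ₚ
    dot-top≡0 u σ≡0 = trans (dot-top u) (trans (cong (-1ₚ *ₚ_) σ≡0) (*ₚ-zeroʳ -1ₚ))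

    dot-top≢0 : ∀ u → σ u ≢ 0ₚ → u · aᴹ ≢ 0ₚ
    dot-top≢0 u σ≢0 eq with *ₚ-noZeroDivisors p-prime -1ₚ (σ u) (trans (sym (dot-top u)) eq)
    ... | inj₁ -1≡0 = contradiction -1≡0 (-1ₚ≢0ₚ 1<p)
    ... | inj₂ σ≡0 = σ≢0 σ≡0

    σ≢0⇒¬V : ∀ u → σ u ≢ 0ₚ → ¬ V u
    σ≢0⇒¬V u σ≢0 z = σ≢0 (S⇒σ u (V⇒S u z))

    p^ : ℕ → ℤ
    p^ k = + (p ^ k)

    p-1 : ℤ
    p-1 = + p - 1ℤ

    suc-∸1 : ∀ {k} → 1 ≤ k → k ≡ suc (k ∸ 1)
    suc-∸1 1≤k = sym (ℕ.m+[n∸m]≡n 1≤k)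

    ∣M∣≡m : ∣ M ∣ ≡ m
    ∣M∣≡m = ∣initial∣ m≤n

  codeLength : + length (points D?) ≡ p^ n - p^ m - p^ b + 1ℤ
  codeLength = begin
    card D?
      ≡⟨ cong +_ (#-cong D? (D? ∩? U?) ((_, tt) , proj₁)) ⟩
    card (D? ∩? U?)
      ≡⟨ card-definingSet 1<p B m≤B U? ⟩
    card (U? {A = Vec (Fin p) n}) -
      (card (flat? M 0ᵛ ∩? U?) + card (flat? B aᴹ ∩? U?) - card (flat? ⊥ aᴹ ∩? U?))
      ≡⟨ cong₂ (λ i j → (+ i) - j) (#-U n) (cong₂ (λ i j → i - (+ j))
           (cong₂ (λ i j → (+ i) + (+ j)) (trans (size M 0ᵛ) (cong (p ^_) ∣M∣≡m)) (size B aᴹ))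
           (trans (size ⊥ aᴹ) (cong (p ^_) (∣⊥∣≡0 n)))) ⟩
    p^ n - (p^ m + p^ b - 1ℤ)
      ≡⟨ rearrange (p^ n) (p^ m) (p^ b) ⟩
    p^ n - p^ m - p^ b + 1ℤ
      ∎
    where
    open ≡-Reasoning
    size : ∀ F (a : Vec (Fin p) n) → # (flat? F a ∩? U?) ≡ p ^ ∣ F ∣
    size F a = trans (#-cong (flat? F a ∩? U?) (flat? F a) (proj₁ , (_, tt))) (#-flat F a)
    rearrange : ∀ x y z → x - (y + z - 1ℤ) ≡ x - y - z + 1ℤ
    rearrange = ℤ-Solver.solve-∀

  isCode : IsCode[ p^ n - p^ m - p^ b + 1ℤ , n ] (Code D?)
  isCode = codeLength , Code-isLinear D? ,
           Code-hasDimension D? (definingSet-separates 2<p 1≤m m<n B)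

------------------------------------------------------------------------
-- The weights

  private
    -- The weight in terms of the three counts of x with u · x nonzero: x₁ in the flat of M,
    -- x₂ in the flat of B, and x₃ at the common point.
    wt≡ : ∀ u {x₁ x₂ x₃} → u ≢ 0ᵛ →
          card (flat? M 0ᵛ ∩? nonzeroDot? u) ≡ x₁ →
          card (flat? B aᴹ ∩? nonzeroDot? u) ≡ x₂ →
          card (flat? ⊥ aᴹ ∩? nonzeroDot? u) ≡ x₃ →
          + wt (codeword D? u) ≡ p-1 * p^ (n ∸ 1) - (x₁ + x₂ - x₃)
    wt≡ u u≢0 x₁≡ x₂≡ x₃≡ = trans (cong +_ (wt-codeword D? u))
      (trans (card-definingSet 1<p B m≤B (nonzeroDot? u))
        (cong₂ _-_ (card-nonzeroDot p-prime u (suc-∸1 (ℕ.≤-trans 1≤m m≤n)) u≢0)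
                   (cong₂ _-_ (cong₂ _+_ x₁≡ x₂≡) x₃≡)))

    dot-0ʳ : ∀ u → u · 0ᵛ ≡ 0ₚ {p}
    dot-0ʳ u = trans (dot-comm {n = n} u 0ᵛ) (dot-0ˡ u)

    x₁-V : ∀ u → V u → card (flat? M 0ᵛ ∩? nonzeroDot? u) ≡ 0ℤ
    x₁-V u z = card-flat-zeroDot M 0ᵛ u z (dot-0ʳ u)

    x₁-¬V : ∀ u → ¬ V u → card (flat? M 0ᵛ ∩? nonzeroDot? u) ≡ p-1 * p^ (m ∸ 1)
    x₁-¬V u ¬z = card-flat-nonzeroDot p-prime M 0ᵛ u ¬z (trans ∣M∣≡m (suc-∸1 1≤m))

    x₂-¬Δ : ∀ u → ¬ Δ u → card (flat? B aᴹ ∩? nonzeroDot? u) ≡ p-1 * p^ (b ∸ 1)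
    x₂-¬Δ u ¬z = card-flat-nonzeroDot p-prime B aᴹ u ¬z (suc-∸1 1≤b)

    x₂-Δ,σ≡0 : ∀ u → Δ u → σ u ≡ 0ₚ → card (flat? B aᴹ ∩? nonzeroDot? u) ≡ 0ℤ
    x₂-Δ,σ≡0 u z σ≡0 = card-flat-zeroDot B aᴹ u z (dot-top≡0 u σ≡0)

    x₂-Δ,σ≢0 : ∀ u → Δ u → σ u ≢ 0ₚ → card (flat? B aᴹ ∩? nonzeroDot? u) ≡ p^ b
    x₂-Δ,σ≢0 u z σ≢0 = card-flat-constDot B aᴹ u z (dot-top≢0 u σ≢0)

    x₃-σ≡0 : ∀ u → σ u ≡ 0ₚ → card (flat? ⊥ aᴹ ∩? nonzeroDot? u) ≡ 0ℤ
    x₃-σ≡0 u σ≡0 = card-flat-zeroDot ⊥ aᴹ u (λ i i∈ → contradiction i∈ ∉⊥) (dot-top≡0 u σ≡0)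

    x₃-σ≢0 : ∀ u → σ u ≢ 0ₚ → card (flat? ⊥ aᴹ ∩? nonzeroDot? u) ≡ 1ℤ
    x₃-σ≢0 u σ≢0 = trans
      (card-flat-constDot ⊥ aᴹ u (λ i i∈ → contradiction i∈ ∉⊥) (dot-top≢0 u σ≢0))
      (cong p^ (∣⊥∣≡0 n))

    -- The weights of the table, in order.
    w₁ w₂ w₃ w₄ w₅ w₆ : ℤ
    w₁ = p-1 * p^ (n ∸ 1)
    w₂ = p-1 * (p^ (n ∸ 1) - p^ (b ∸ 1))
    w₃ = p-1 * (p^ (n ∸ 1) - p^ (m ∸ 1))
    w₄ = p-1 * (p^ (n ∸ 1) - p^ (m ∸ 1) - p^ (b ∸ 1))
    w₅ = p-1 * (p^ (n ∸ 1) - p^ (m ∸ 1)) - p^ b + 1ℤ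
    w₆ = p-1 * (p^ (n ∸ 1) - p^ (m ∸ 1) - p^ (b ∸ 1)) + 1ℤ

    wt₁ : ∀ u → u ≢ 0ᵛ → V u → Δ u → + wt (codeword D? u) ≡ w₁
    wt₁ u u≢0 z y = trans
      (wt≡ u u≢0 (x₁-V u z) (x₂-Δ,σ≡0 u y (S⇒σ u (V⇒S u z))) (x₃-σ≡0 u (S⇒σ u (V⇒S u z))))
      (rearrange (p-1 * p^ (n ∸ 1)))
      where
      rearrange : ∀ a → a - 0ℤ ≡ a
      rearrange = ℤ-Solver.solve-∀

    wt₂ : ∀ u → u ≢ 0ᵛ → V u → ¬ Δ u → + wt (codeword D? u) ≡ w₂
    wt₂ u u≢0 z ¬y = trans
      (wt≡ u u≢0 (x₁-V u z) (x₂-¬Δ u ¬y) (x₃-σ≡0 u (S⇒σ u (V⇒S u z))))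
      (rearrange p-1 (p^ (n ∸ 1)) (p^ (b ∸ 1)))
      where
      rearrange : ∀ q x z → q * x - (0ℤ + q * z - 0ℤ) ≡ q * (x - z)
      rearrange = ℤ-Solver.solve-∀

    wt₃ : ∀ u → u ≢ 0ᵛ → ¬ V u → σ u ≡ 0ₚ → Δ u → + wt (codeword D? u) ≡ w₃
    wt₃ u u≢0 ¬z σ≡0 y = trans
      (wt≡ u u≢0 (x₁-¬V u ¬z) (x₂-Δ,σ≡0 u y σ≡0) (x₃-σ≡0 u σ≡0))
      (rearrange p-1 (p^ (n ∸ 1)) (p^ (m ∸ 1)))
      where
      rearrange : ∀ q x z → q * x - (q * z + 0ℤ - 0ℤ) ≡ q * (x - z)
      rearrange = ℤ-Solver.solve-∀

    wt₄ : ∀ u → u ≢ 0ᵛ → ¬ V u → σ u ≡ 0ₚ → ¬ Δ u → + wt (codeword D? u) ≡ w₄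
    wt₄ u u≢0 ¬z σ≡0 ¬y = trans
      (wt≡ u u≢0 (x₁-¬V u ¬z) (x₂-¬Δ u ¬y) (x₃-σ≡0 u σ≡0))
      (rearrange p-1 (p^ (n ∸ 1)) (p^ (m ∸ 1)) (p^ (b ∸ 1)))
      where
      rearrange : ∀ q x y z → q * x - (q * y + q * z - 0ℤ) ≡ q * (x - y - z)
      rearrange = ℤ-Solver.solve-∀

    wt₅ : ∀ u → u ≢ 0ᵛ → σ u ≢ 0ₚ → Δ u → + wt (codeword D? u) ≡ w₅
    wt₅ u u≢0 σ≢0 y = trans
      (wt≡ u u≢0 (x₁-¬V u (σ≢0⇒¬V u σ≢0)) (x₂-Δ,σ≢0 u y σ≢0) (x₃-σ≢0 u σ≢0))
      (rearrange p-1 (p^ (n ∸ 1)) (p^ (m ∸ 1)) (p^ b))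
      where
      rearrange : ∀ q x y z → q * x - (q * y + z - 1ℤ) ≡ q * (x - y) - z + 1ℤ
      rearrange = ℤ-Solver.solve-∀

    wt₆ : ∀ u → u ≢ 0ᵛ → σ u ≢ 0ₚ → ¬ Δ u → + wt (codeword D? u) ≡ w₆
    wt₆ u u≢0 σ≢0 ¬y = trans
      (wt≡ u u≢0 (x₁-¬V u (σ≢0⇒¬V u σ≢0)) (x₂-¬Δ u ¬y) (x₃-σ≢0 u σ≢0))
      (rearrange p-1 (p^ (n ∸ 1)) (p^ (m ∸ 1)) (p^ (b ∸ 1)))
      where
      rearrange : ∀ q x y z → q * x - (q * y + q * z - 1ℤ) ≡ q * (x - y - z) + 1ℤ
      rearrange = ℤ-Solver.solve-∀

  atMostSixWeights : AtMostNonzeroWeights 6 (Code D?)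
  atMostSixWeights = weights , ℕ.≤-refl , λ { _ (u , refl) wt≢0 → listed u (≢0 u wt≢0) }
    where
    weights : List ℕ
    weights = List.map ℤ.∣_∣ (w₁ ∷ w₂ ∷ w₃ ∷ w₄ ∷ w₅ ∷ w₆ ∷ [])
    ≢0 : ∀ u → wt (codeword D? u) ≢ 0 → u ≢ 0ᵛ
    ≢0 u wt≢0 refl = wt≢0 (trans (wt-codeword D? 0ᵛ)
      (count-none (D? ∩? nonzeroDot? 0ᵛ) (λ x (_ , nz) → nz (dot-0ˡ x)) (allVecs p n)))
    listed : ∀ u → u ≢ 0ᵛ → wt (codeword D? u) List.∈ weights
    listed u u≢0 with V? u | σ u Fin.≟ 0ₚ | Δ? u
    ... | yes z | _       | yes y = here (cong ℤ.∣_∣ (wt₁ u u≢0 z y))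
    ... | yes z | _       | no ¬y = there (here (cong ℤ.∣_∣ (wt₂ u u≢0 z ¬y)))
    ... | no ¬z | yes σ≡0 | yes y = there (there (here (cong ℤ.∣_∣ (wt₃ u u≢0 ¬z σ≡0 y))))
    ... | no ¬z | yes σ≡0 | no ¬y = there (there (there (here (cong ℤ.∣_∣ (wt₄ u u≢0 ¬z σ≡0 ¬y)))))
    ... | no ¬z | no σ≢0  | yes y = there (there (there (there (here (cong ℤ.∣_∣ (wt₅ u u≢0 σ≢0 y))))))
    ... | no ¬z | no σ≢0  | no ¬y = there (there (there (there (there (here (cong ℤ.∣_∣ (wt₆ u u≢0 σ≢0 ¬y)))))))

------------------------------------------------------------------------
-- The frequencies

  private
    e : ℕ
    e = n ∸ m ∸ b

    -- The numbers of w with w zero on B, and of all w.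
    E C : ℤ
    E = p^ e
    C = p^ (n ∸ m)

    n≡m+ : n ≡ m ℕ.+ (n ∸ m)
    n≡m+ = sym (ℕ.m+[n∸m]≡n m≤n)

    n∸b≡m+e : n ∸ b ≡ m ℕ.+ e
    n∸b≡m+e = trans (cong (_∸ b) n≡m+) (ℕ.+-∸-assoc m b≤n∸m)

    ∸1-+ : ∀ {k} l → k ≡ m ℕ.+ l → k ∸ 1 ≡ (m ∸ 1) ℕ.+ l
    ∸1-+ l refl = ℕ.+-∸-comm l 1≤m

    p^-+ : ∀ {k} i j → k ≡ i ℕ.+ j → p^ k ≡ p^ i * p^ j
    p^-+ i j refl = trans (cong +_ (ℕ.^-distribˡ-+-* p i j)) (ℤ.pos-* (p ^ i) (p ^ j))

    M∩B≡∅ : ∀ i → i ∈ M → i ∉ B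
    M∩B≡∅ i i∈M i∈B = ℕ.<⇒≱ (∈-initial⁻ i∈M) (m≤B i i∈B)

    i₀ : Fin n
    i₀ = Fin.fromℕ< (ℕ.<-trans 1≤m m<n)

    i₀∈M : i₀ ∈ M
    i₀∈M = ∈-initial⁺ (subst (_< m) (sym (Fin.toℕ-fromℕ< _)) 1≤m)

    1ᴹ-nonzero : ∀ {F} → i₀ ∈ F → ¬ ZeroOn F 1ᴹ
    1ᴹ-nonzero i₀∈F z = 1ₚ≢0ₚ 1<p (trans (sym (lookup-indicator-∈ i₀∈M)) (z i₀ i₀∈F))

    -- The sizes of the sets from which the conditions of the table are built.

    #V : card V? ≡ C
    #V = cong +_ (trans (#-zeroOn M) (cong (λ k → p ^ (n ∸ k)) ∣M∣≡m))

    #Δ : card Δ? ≡ p^ m * E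
    #Δ = trans (cong +_ (#-zeroOn B)) (p^-+ m e n∸b≡m+e)

    #V∩Δ : card (V? ∩? Δ?) ≡ E
    #V∩Δ = cong +_ (begin
      # (V? ∩? Δ?)               ≡⟨ #-cong (V? ∩? Δ?) (zeroOn? (M ∪ˢ B))
                                      ((λ (z , y) i → Sum.[ z i , y i ] ∘ x∈p∪q⁻ M B) ,
                                       (λ z → (λ i → z i ∘ x∈p∪q⁺ ∘ inj₁) ,
                                              (λ i → z i ∘ x∈p∪q⁺ ∘ inj₂))) ⟩
      # (zeroOn? {p} (M ∪ˢ B))   ≡⟨ #-zeroOn (M ∪ˢ B) ⟩
      p ^ (n ∸ ∣ M ∪ˢ B ∣)       ≡⟨ cong (λ k → p ^ (n ∸ k)) (trans (∣p∪q∣≡∣p∣+∣q∣ M B M∩B≡∅)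
                                      (cong (ℕ._+ b) ∣M∣≡m)) ⟩
      p ^ (n ∸ (m ℕ.+ b))        ≡⟨ cong (p ^_) (ℕ.∸-+-assoc n m b) ⟨
      p ^ e                      ∎)
      where open ≡-Reasoning

    #S : card S? ≡ p^ (m ∸ 1) * C
    #S = trans (cong +_ (trans
        (#-cong S? (flatSection? ⊤ 0ᵛ 0ₚ 1ᴹ) ((λ {x} s → Flat-⊤ 0ᵛ x , s) , proj₂))
        (#-flat-hyperplane p-prime ⊤ 0ᵛ 1ᴹ (1ᴹ-nonzero ∈⊤)
          (trans (∣⊤∣≡n n) (suc-∸1 (ℕ.≤-trans 1≤m m≤n))))))
      (p^-+ (m ∸ 1) (n ∸ m) (∸1-+ (n ∸ m) n≡m+))

    #S∩Δ : card (S? ∩? Δ?) ≡ p^ (m ∸ 1) * E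
    #S∩Δ = trans (cong +_ (trans
        (#-cong (S? ∩? Δ?) (flatSection? (∁ B) 0ᵛ 0ₚ 1ᴹ)
          ((λ {x} (s , y) → proj₁ (ZeroOn≐Flat B) {x} y , s) ,
           (λ {x} (y , s) → s , proj₂ (ZeroOn≐Flat B) {x} y)))
        (#-flat-hyperplane p-prime (∁ B) 0ᵛ 1ᴹ (1ᴹ-nonzero (x∉p⇒x∈∁p (M∩B≡∅ i₀ i₀∈M)))
          (trans (∣∁p∣≡n∸∣p∣ B)
                 (suc-∸1 (subst (1 ≤_) (sym n∸b≡m+e) (ℕ.≤-trans 1≤m (ℕ.m≤m+n m e))))))))
      (p^-+ (m ∸ 1) e (∸1-+ e n∸b≡m+e))

    #∁Δ : card (∁? Δ?) ≡ p^ m * C - p^ m * E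
    #∁Δ = trans (card-∖ U? Δ? (∁? Δ?) (λ _ → tt) ((tt ,_) , proj₂))
      (cong₂ _-_ (trans (cong +_ (#-U n)) (p^-+ m (n ∸ m) n≡m+)) #Δ)

    #S∩∁Δ : card (S? ∩? ∁? Δ?) ≡ p^ (m ∸ 1) * C - p^ (m ∸ 1) * E
    #S∩∁Δ = trans (card-∩∁ S? Δ?) (cong₂ _-_ #S #S∩Δ)

    #V∩∁Δ : card (V? ∩? ∁? Δ?) ≡ C - E
    #V∩∁Δ = trans (card-∩∁ V? Δ?) (cong₂ _-_ #V #V∩Δ)

    zero? : Decidable (_≡ 0ᵛ {p} {n})
    zero? u = Vec.≡-dec Fin._≟_ u 0ᵛ

    ¬V⇒≢0 : ∀ u → ¬ V u → u ≢ 0ᵛ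
    ¬V⇒≢0 _ ¬z refl = ¬z (ZeroOn-0ᵛ M)

    ¬Δ⇒≢0 : ∀ u → ¬ Δ u → u ≢ 0ᵛ
    ¬Δ⇒≢0 _ ¬y refl = ¬y (ZeroOn-0ᵛ B)

    ¬S⇒≢0 : ∀ u → ¬ S u → u ≢ 0ᵛ
    ¬S⇒≢0 _ ¬s refl = ¬s (V⇒S 0ᵛ (ZeroOn-0ᵛ M))

  row₁ : Row (codeword D?) (λ u → v u ≡ 0ᵛ × δ B u ≡ 1) w₁ (E - 1ℤ)
  row₁ = (λ u u≢0 (z , y) → wt₁ u u≢0 (v⇒V u z) (δ⇒Δ u y)) ,
    hasSize-∖ (V? ∩? Δ?) zero? (λ { refl → ZeroOn-0ᵛ M , ZeroOn-0ᵛ B })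
      (λ u (u≢0 , z , y) → (v⇒V u z , δ⇒Δ u y) , u≢0)
      (λ u (z , y) u≢0 → u≢0 , V⇒v u z , Δ⇒δ u y)
      (cong₂ _-_ #V∩Δ (cong +_ (#-unique zero? refl (λ eq → eq))))

  row₂ : Row (codeword D?) (λ u → v u ≡ 0ᵛ × δ B u ≡ 0) w₂ (C - E)
  row₂ = (λ u u≢0 (z , y) → wt₂ u u≢0 (v⇒V u z) (δ⇒¬Δ u y)) ,
    hasSize-∖ V? (V? ∩? Δ?) proj₁
      (λ u (_ , z , y) → v⇒V u z , δ⇒¬Δ u y ∘ proj₂)
      (λ u z ¬zy → let ¬y = λ y → ¬zy (z , y) in
        ¬Δ⇒≢0 u ¬y , V⇒v u z , ¬Δ⇒δ u ¬y)
      (cong₂ _-_ #V #V∩Δ)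

  row₃ : Row (codeword D?) (λ u → v u ≢ 0ᵛ × σ u ≡ 0ₚ × δ B u ≡ 1)
             w₃ ((p^ (m ∸ 1) - 1ℤ) * E)
  row₃ = (λ u u≢0 (¬z , s , y) → wt₃ u u≢0 (¬z ∘ V⇒v u) s (δ⇒Δ u y)) ,
    hasSize-∖ (S? ∩? Δ?) (V? ∩? Δ?) (λ {u} (z , y) → V⇒S u z , y)
      (λ u (_ , ¬z , s , y) → (σ⇒S u s , δ⇒Δ u y) , ¬z ∘ V⇒v u ∘ proj₁)
      (λ u (s , y) ¬zy → let ¬z = λ z → ¬zy (z , y) in
        ¬V⇒≢0 u ¬z , ¬z ∘ v⇒V u , S⇒σ u s , Δ⇒δ u y)
      (trans (cong₂ _-_ #S∩Δ #V∩Δ) (rearrange (p^ (m ∸ 1)) E))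
    where
    rearrange : ∀ a x → a * x - x ≡ (a - 1ℤ) * x
    rearrange = ℤ-Solver.solve-∀

  row₄ : Row (codeword D?) (λ u → v u ≢ 0ᵛ × σ u ≡ 0ₚ × δ B u ≡ 0)
             w₄ ((p^ (m ∸ 1) - 1ℤ) * (C - E))
  row₄ = (λ u u≢0 (¬z , s , y) → wt₄ u u≢0 (¬z ∘ V⇒v u) s (δ⇒¬Δ u y)) ,
    hasSize-∖ (S? ∩? ∁? Δ?) (V? ∩? ∁? Δ?) (λ {u} (z , ¬y) → V⇒S u z , ¬y)
      (λ u (_ , ¬z , s , y) → (σ⇒S u s , δ⇒¬Δ u y) , ¬z ∘ V⇒v u ∘ proj₁)
      (λ u (s , ¬y) ¬zy → let ¬z = λ z → ¬zy (z , ¬y) in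
        ¬V⇒≢0 u ¬z , ¬z ∘ v⇒V u , S⇒σ u s , ¬Δ⇒δ u ¬y)
      (trans (cong₂ _-_ #S∩∁Δ #V∩∁Δ) (rearrange (p^ (m ∸ 1)) C E))
    where
    rearrange : ∀ a x y → a * x - a * y - (x - y) ≡ (a - 1ℤ) * (x - y)
    rearrange = ℤ-Solver.solve-∀

  row₅ : Row (codeword D?) (λ u → σ u ≢ 0ₚ × δ B u ≡ 1) w₅ ((p^ m - p^ (m ∸ 1)) * E)
  row₅ = (λ u u≢0 (¬s , y) → wt₅ u u≢0 ¬s (δ⇒Δ u y)) ,
    hasSize-∖ Δ? (S? ∩? Δ?) proj₂
      (λ u (_ , ¬s , y) → δ⇒Δ u y , ¬s ∘ S⇒σ u ∘ proj₁)
      (λ u y ¬sy → let ¬s = λ s → ¬sy (s , y) in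
        ¬S⇒≢0 u ¬s , ¬s ∘ σ⇒S u , Δ⇒δ u y)
      (trans (cong₂ _-_ #Δ #S∩Δ) (rearrange (p^ m) (p^ (m ∸ 1)) E))
    where
    rearrange : ∀ a b x → a * x - b * x ≡ (a - b) * x
    rearrange = ℤ-Solver.solve-∀

  row₆ : Row (codeword D?) (λ u → σ u ≢ 0ₚ × δ B u ≡ 0) w₆ ((p^ m - p^ (m ∸ 1)) * (C - E))
  row₆ = (λ u u≢0 (¬s , y) → wt₆ u u≢0 ¬s (δ⇒¬Δ u y)) ,
    hasSize-∖ (∁? Δ?) (S? ∩? ∁? Δ?) proj₂
      (λ u (_ , ¬s , y) → δ⇒¬Δ u y , ¬s ∘ S⇒σ u ∘ proj₁)
      (λ u ¬y ¬sy → let ¬s = λ s → ¬sy (s , ¬y) in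
        ¬S⇒≢0 u ¬s , ¬s ∘ σ⇒S u , ¬Δ⇒δ u ¬y)
      (trans (cong₂ _-_ #∁Δ #S∩∁Δ) (rearrange (p^ m) (p^ (m ∸ 1)) C E))
    where
    rearrange : ∀ a b x y → a * x - a * y - (b * x - b * y) ≡ (a - b) * (x - y)
    rearrange = ℤ-Solver.solve-∀

------------------------------------------------------------------------
-- The code and its weight distribution

theorem4p3 : (p : ℕ) .{{_ : NonZero p}} → Prime p → 2 ∤ p →
  (m n : ℕ) → 1 ≤ m → (m<n : m < n) →
  (B : Subset n) → (∀ i → i ∈ B → m ≤ toℕ i) →
  (b : ℕ) → ∣ B ∣ ≡ b → 1 ≤ b → b ≤ n ∸ m →
  let D? = definingSet? {p} m B
      c  = codeword D?
      v  = head[_] {p} m<n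
      σ  = λ u → sumₚ (v u)
      p^ = λ k → + (p ^ k)
      p-1 = + p - 1ℤ
      Q  = p-1 * p^ (n ∸ 1)
      c₁ = p^ (n ∸ m ∸ b)
      c₀ = p^ (n ∸ m) - p^ (n ∸ m ∸ b)
  in
    IsCode[ p^ n - p^ m - p^ b + 1ℤ , n ] (Code D?)
  × AtMostNonzeroWeights 6 (Code D?)
  × Row c (λ u → v u ≡ 0ᵛ × δ B u ≡ 1)
      Q
      (c₁ - 1ℤ)
  × Row c (λ u → v u ≡ 0ᵛ × δ B u ≡ 0)
      (p-1 * (p^ (n ∸ 1) - p^ (b ∸ 1)))
      c₀
  × Row c (λ u → v u ≢ 0ᵛ × σ u ≡ 0ₚ × δ B u ≡ 1)
      (p-1 * (p^ (n ∸ 1) - p^ (m ∸ 1)))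
      ((p^ (m ∸ 1) - 1ℤ) * c₁)
  × Row c (λ u → v u ≢ 0ᵛ × σ u ≡ 0ₚ × δ B u ≡ 0)
      (p-1 * (p^ (n ∸ 1) - p^ (m ∸ 1) - p^ (b ∸ 1)))
      ((p^ (m ∸ 1) - 1ℤ) * c₀)
  × Row c (λ u → σ u ≢ 0ₚ × δ B u ≡ 1)
      (p-1 * (p^ (n ∸ 1) - p^ (m ∸ 1)) - p^ b + 1ℤ)
      ((p^ m - p^ (m ∸ 1)) * c₁)
  × Row c (λ u → σ u ≢ 0ₚ × δ B u ≡ 0)
      (p-1 * (p^ (n ∸ 1) - p^ (m ∸ 1) - p^ (b ∸ 1)) + 1ℤ)
      ((p^ m - p^ (m ∸ 1)) * c₀)
theorem4p3 p p-prime 2∤p m n 1≤m m<n B m≤B .(∣ B ∣) refl 1≤b b≤n∸m =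
  isCode , atMostSixWeights , row₁ , row₂ , row₃ , row₄ , row₅ , row₆
  where open WeightDistribution p-prime 2∤p 1≤m m<n B m≤B 1≤b b≤n∸m
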